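{- Let $H=(V,E,w)$ be a weighted undirected hypergraph with source $s\in V$, and let the weight of a hyperedge $\check e\in E$ increase to $w_{new}$. Let $d[v]$ and $d'[v]$ denote the shortest distance from $s$ to $v$ before and after the change, respectively. Suppose that before the weight increase $D[v]=d[v]$ and $E[v]$, $P[v]$ are correct for all $v\in V$. Then after the algorithm HE-DSP: Weight Increase$(\check e,w_{new})$ (given in the context) has been executed, $D[v]=d'[v]$ and also $E[v]$ and $P[v]$ are correctly updated (i.e. they are correct for the hypergraph with the new weight) for all $v\in V$.
   Context: A weighted undirected hypergraph $H=(V,E,w)$ consists of a finite set $V$, a family $E$ of nonempty subsets of $V$ (hyperedges) with $\bigcup_{e\in E}e=V$, and a weight function $w:E\to\mathbb{R}^+\cup\{0\}$. A hyperpath between $u$ and $v$ is a sequence of hyperedges $\{e_0,\dots,e_m\}$ with $u\in e_0$, $v\in e_m$ and $e_i\cap e_{i+1}\neq\emptyset$ for $i=0,\dots,m-1$; its weight is $\sum_{i=0}^m w(e_i)$. The shortest distance of $v$ is the minimum weight of a hyperpath from $s$ to $v$ ($0$ for $v=s$, $+\infty$ if there is none). Two vertices are neighbors if some hyperedge contains both. The algorithm stores for each vertex $v$: $D[v]$ (current distance value), $P[v]$ (parent of $v$), and $E[v]$ (the hyperedge containing $v$ and $P[v]$ that leads from $P[v]$ to $v$ on the shortest hyperpath). "$P$ and $E$ are correct" means that they describe shortest hyperpaths from $s$: the parent pointers form a tree rooted at $s$ (a relationship tree) on the vertices reachable from $s$, and for each reachable $v\neq s$, $E[v]$ contains $v$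 and $P[v]$, and the shortest distance of $v$ equals the shortest distance of $P[v]$ plus $w(E[v])$; thus following the pointers from $v$ back to $s$ gives a shortest hyperpath to $v$. The children of $z$ are the vertices $v$ with $P[v]=z$. Algorithm HE-DSP: Weight Increase$(\check e,w_{new})$. $M$ and $Q$ are initially empty priority queues of vertices keyed by $D$; Dequeue removes and returns a vertex with smallest key. At any time a vertex is "nonred" if it has not been colored red so far. Step 0. Set $w(\check e)\leftarrow w_{new}$. Step 1. For each $v\in\check e$ with $E[v]=\check e$, enqueue $v$ into $M$ with key $D[v]$. Step 2 (coloring process). While $M$ is nonempty: dequeue $z$ from $M$; if there exist a nonred $q\in V$ and $e\in E$ with $q,z\in e$ and $D[q]+w(e)=D[z]$, then color $z$ pink and set $P[z]\leftarrow q$, $E[z]\leftarrow e$; otherwise color $z$ red and enqueue all children of $z$ into $M$. Step 3.a. For each red vertex $z$: if $z$ has no nonred neighbor, set $D[z]\leftarrow+\infty$, $P[z]\leftarrow$ Null; otherwise let $u$ be the best nonred neighbor of $z$ (the one giving $z$ the smallest distance $D[u]+\min_{e\ni u,z}w(e)$), set $E[z]\leftarrow\arg\min_{e\in E,\,e\ni u,z}w(e)$, $D[z]\leftarrow D[u]+w(E[z])$, $P[z]\leftarrow u$, and enqueue $z$ into $Q$ with key $D[z]$. Step 3.b. While $Q$ is nonempty: dequeue $z$ from $Q$; for each $e\in E$ with $z\in e$ and each $v\in e$, if $D[v]>D[z]+w(e)$, set $D[v]\leftarrow D[z]+w(e)$, $P[v]\leftarrow z$, $E[v]\leftarrow e$,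 and enqueue $v$ into $Q$ with key $D[v]$ (or update its key if it is already in $Q$).
   Formalization: All hyperedge weights after the increase are assumed positive: with zero weights the claim fails, since a vertex can be supported by itself or by its own descendant. Weights lie in any totally ordered abelian group with decidable order (classically including the reals). -}

module Defs where

open import Algebra.Structures using (IsAbelianGroup)
open import Data.Bool.Base using (if_then_else_)
open import Data.Fin.Base using (Fin)
open import Data.Fin.Properties using () renaming (_≟_ to _≟ᶠ_)
open import Data.Fin.Subset
  using (Subset; _∈_; _∉_; Nonempty; Empty; _∩_; _∪_; ⁅_⁆)
  renaming (⊥ to ∅; _-_ to _∖_)
open import Data.Fin.Subset.Properties using (_∈?_)
open import Data.List.Base using (List; foldl)
import Data.List.Membership.Propositional as List
open import Data.Maybe.Base using (Maybe; just; nothing; map)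
open import Data.Maybe.Properties using (≡-dec)
open import Data.Nat.Base using (ℕ)
open import Data.Product.Base using (∃; ∃₂; _×_; _,_; proj₁)
import Data.Vec.Base as Vec
open import Data.Vec.Functional using (Vector; updateAt)
open import Data.Vec.Functional.Properties using (updateAt-updates; updateAt-minimal)
open import Function.Base using (const)
open import Function.Bundles using (_⇔_)
open import Level using (Level; suc; _⊔_)
open import Relation.Binary.Construct.Closure.ReflexiveTransitive using (Star)
import Relation.Binary.Construct.Add.Supremum.Equality as Add≈
import Relation.Binary.Construct.Add.Supremum.NonStrict as Add≤
import Relation.Binary.Construct.Add.Supremum.Strict as Add<
import Relation.Binary.Construct.NonStrictToStrict as ToStrict
open import Relation.Binary.Core using (Rel)
open import Relation.Binary.Definitions using (Decidable)
open import Relation.Binary.PropositionalEquality.Core using (_≡_; _≢_; refl; sym; subst)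
open import Relation.Binary.Structures using (IsDecTotalOrder)
open import Relation.Nullary.Construct.Add.Supremum using (_⁺; ⊤⁺; [_])
open import Relation.Nullary.Decidable.Core using (does; yes; no; _×-dec_)
open import Relation.Nullary.Negation.Core using (¬_)

private
  variable
    c ℓ₁ ℓ₂ : Level
    n m : ℕ

-- Weights are taken in an arbitrary totally ordered abelian group, of which
-- the additive group of the real numbers is (classically) an instance.
record OrderedAbelianGroup c ℓ₁ ℓ₂ : Set (suc (c ⊔ ℓ₁ ⊔ ℓ₂)) where
  infixl 6 _+_
  infix  4 _≈_ _≤_ _<_
  field
    Carrier         : Set c
    _≈_             : Rel Carrier ℓ₁
    _≤_             : Rel Carrier ℓ₂
    _+_             : Carrier → Carrier → Carrier
    0#              : Carrier
    -_              : Carrier → Carrier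
    isAbelianGroup  : IsAbelianGroup _≈_ _+_ 0# -_
    isDecTotalOrder : IsDecTotalOrder _≈_ _≤_
    +-monoʳ-≤       : ∀ x {y z} → y ≤ z → x + y ≤ x + z

  open IsAbelianGroup isAbelianGroup public
    using (assoc; comm; identityˡ; identityʳ; inverseˡ; inverseʳ; ∙-cong; ⁻¹-cong)
  open IsDecTotalOrder isDecTotalOrder public
    using (total; antisym; _≟_; _≤?_; module Eq; ≤-resp-≈)
    renaming (refl to ≤-refl; trans to ≤-trans; reflexive to ≤-reflexive)

  _<_ : Rel Carrier (ℓ₁ ⊔ ℓ₂)
  _<_ = ToStrict._<_ _≈_ _≤_

  <⇒≤ : ∀ {x y} → x < y → x ≤ y
  <⇒≤ = proj₁

  _<?_ : Decidable _<_
  _<?_ = ToStrict.<-decidable _≈_ _≤_ _≟_ _≤?_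

  -- Distances; ⊤⁺ is +∞.
  Distance : Set c
  Distance = Carrier ⁺

  open Add≈ _≈_ public using (_≈⁺_)
  open Add≤ _≤_ public using (_≤⁺_)
  open Add< _<_ public using (_<⁺_)

  _<⁺?_ : Decidable _<⁺_
  _<⁺?_ = Add<.<⁺-dec _<_ _<?_

  infixl 6 _+⁺_
  _+⁺_ : Distance → Carrier → Distance
  x +⁺ y = map (_+ y) x

record Hypergraph (G : OrderedAbelianGroup c ℓ₁ ℓ₂) (n m : ℕ) : Set (c ⊔ ℓ₂) where
  open OrderedAbelianGroup G using (Carrier; _≤_; 0#)
  field
    edge     : Fin m → Subset n
    nonempty : ∀ e → Nonempty (edge e)
    covering : ∀ v → ∃ λ e → v ∈ edge e
    weight   : Fin m → Carrier
    0≤weight : ∀ e → 0# ≤ weight e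

module _ {G : OrderedAbelianGroup c ℓ₁ ℓ₂} where
  open OrderedAbelianGroup G

  increaseWeight : (H : Hypergraph G n m) (ě : Fin m) (wₙₑᵥ : Carrier) →
                   Hypergraph.weight H ě < wₙₑᵥ → Hypergraph G n m
  increaseWeight H ě wₙₑᵥ w<wₙₑᵥ = record
    { edge     = edge
    ; nonempty = nonempty
    ; covering = covering
    ; weight   = updateAt weight ě (const wₙₑᵥ)
    ; 0≤weight = 0≤weight′
    }
    where
    open Hypergraph H
    0≤weight′ : ∀ e → 0# ≤ updateAt weight ě (const wₙₑᵥ) e
    0≤weight′ e with e ≟ᶠ ě
    ... | yes refl = subst (0# ≤_) (sym (updateAt-updates ě weight))
                       (≤-trans (0≤weight ě) (<⇒≤ w<wₙₑᵥ))
    ... | no  e≢ě  = subst (0# ≤_) (sym (updateAt-minimal e ě weight e≢ě)) (0≤weight e)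

module _ {G : OrderedAbelianGroup c ℓ₁ ℓ₂} (H : Hypergraph G n m) where
  open OrderedAbelianGroup G
  open Hypergraph H

  -- The algorithm is unsound in the presence of zero weights: in the coloring
  -- process a vertex may then be supported by itself or by one of its own
  -- descendants in the relationship tree.
  PositiveWeights : Set (ℓ₁ ⊔ ℓ₂)
  PositiveWeights = ∀ e → 0# < weight e

  -- Chain e f: sequences of hyperedges from e to f, consecutive ones meeting.
  infixr 5 _∷⟨_⟩_
  data Chain : Fin m → Fin m → Set where
    [_]    : ∀ e → Chain e e
    _∷⟨_⟩_ : ∀ e {e′ f} → Nonempty (edge e ∩ edge e′) → Chain e′ f → Chain e f

  chainWeight : ∀ {e f} → Chain e f → Carrier
  chainWeight [ e ]        = weight e
  chainWeight (e ∷⟨ _ ⟩ p) = weight e + chainWeight p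

  record Hyperpath (u v : Fin n) : Set where
    field
      {first last} : Fin m
      start        : u ∈ edge first
      end          : v ∈ edge last
      chain        : Chain first last

  pathWeight : ∀ {u v} → Hyperpath u v → Carrier
  pathWeight p = chainWeight (Hyperpath.chain p)

  -- The case v ≡ s is separate because a hyperpath is a nonempty sequence, so
  -- one from s to s may have positive weight.
  data IsShortestDistance (s : Fin n) : Fin n → Distance → Set (c ⊔ ℓ₁ ⊔ ℓ₂) where
    source      : ∀ {x} → x ≈ 0# → IsShortestDistance s s [ x ]
    reachable   : ∀ {v x} → v ≢ s →
                  (p : Hyperpath s v) → pathWeight p ≈ x →
                  (∀ (q : Hyperpath s v) → x ≤ pathWeight q) →
                  IsShortestDistance s v [ x ]
    unreachable : ∀ {v} → v ≢ s → ¬ Hyperpath s v → IsShortestDistance s v ⊤⁺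

  ShortestDistances : Fin n → Vector Distance n → Set (c ⊔ ℓ₁ ⊔ ℓ₂)
  ShortestDistances s d = ∀ v → IsShortestDistance s v (d v)

record Store (G : OrderedAbelianGroup c ℓ₁ ℓ₂) (n m : ℕ) : Set c where
  constructor store
  field
    D : Vector (OrderedAbelianGroup.Distance G) n
    P : Vector (Maybe (Fin n)) n
    E : Vector (Maybe (Fin m)) n

module _ {G : OrderedAbelianGroup c ℓ₁ ℓ₂} (H : Hypergraph G n m) where
  open OrderedAbelianGroup G
  open Hypergraph H

  -- P and E describe shortest hyperpaths, d being the shortest distances from s.
  -- Only reachable vertices other than the root s have pointers.
  record CorrectPointers (s : Fin n) (d : Vector Distance n) (σ : Store G n m)
                         : Set (c ⊔ ℓ₁) where
    open Store σ
    field
      root        : P s ≡ nothing × E s ≡ nothing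
      off-tree    : ∀ v → d v ≡ ⊤⁺ → P v ≡ nothing × E v ≡ nothing
      parent      : ∀ v → v ≢ s → d v ≢ ⊤⁺ →
                    ∃₂ λ u e → P v ≡ just u × E v ≡ just e ×
                               v ∈ edge e × u ∈ edge e ×
                               d v ≈⁺ d u +⁺ weight e
      tree        : ∀ v → d v ≢ ⊤⁺ → Star (λ x y → P x ≡ just y) v s

  -- A priority queue is the set of its elements: the key of an element v is the
  -- current D v at all times, and enqueuing an element already present only
  -- updates its key.
  IsDequeued : Vector Distance n → Subset n → Fin n → Set (c ⊔ ℓ₂)
  IsDequeued D Q z = z ∈ Q × (∀ v → v ∈ Q → D z ≤⁺ D v)

  module _ (σ : Store G n m) where
    open Store σ

    usersOf : Fin m → Subset n
    usersOf ě = Vec.tabulate λ v → does (v ∈? edge ě ×-dec ≡-dec _≟ᶠ_ (E v) (just ě))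

    childrenOf : Fin n → Subset n
    childrenOf z = Vec.tabulate λ v → does (≡-dec _≟ᶠ_ (P v) (just z))

    Support : (red : Subset n) (z q : Fin n) (e : Fin m) → Set (c ⊔ ℓ₁)
    Support red z q e =
      q ∉ red × q ∈ edge e × z ∈ edge e × D q +⁺ weight e ≈⁺ D z

  setParent : Store G n m → Fin n → Fin n → Fin m → Store G n m
  setParent (store D P E) z q e =
    store D (updateAt P z (const (just q))) (updateAt E z (const (just e)))

  -- Coloring σ M red σ′ red′: from store σ, queue M and red vertices red, the
  -- coloring process can end with store σ′ and red vertices red′.  Pink vertices
  -- are not recorded, as the algorithm never consults that color.
  data Coloring : Store G n m → Subset n → Subset n →
                  Store G n m → Subset n → Set (c ⊔ ℓ₁ ⊔ ℓ₂) where
    done     : ∀ {σ M red} → Empty M → Coloring σ M red σ red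
    pinkStep : ∀ {σ M red σ′ red′} z q e →
               IsDequeued (Store.D σ) M z → Support σ red z q e →
               Coloring (setParent σ z q e) (M ∖ z) red σ′ red′ →
               Coloring σ M red σ′ red′
    redStep  : ∀ {σ M red σ′ red′} z →
               IsDequeued (Store.D σ) M z → ¬ (∃₂ (Support σ red z)) →
               Coloring σ ((M ∖ z) ∪ childrenOf σ z) (red ∪ ⁅ z ⁆) σ′ red′ →
               Coloring σ M red σ′ red′

  IsLightestThrough : Fin n → Fin n → Fin m → Set ℓ₂
  IsLightestThrough u z e =
    u ∈ edge e × z ∈ edge e ×
    (∀ e′ → u ∈ edge e′ → z ∈ edge e′ → weight e ≤ weight e′)

  NonredNeighbor : Subset n → Fin n → Fin n → Set
  NonredNeighbor red z u = u ∉ red × ∃ λ e → u ∈ edge e × z ∈ edge e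

  IsBestNeighbor : Vector Distance n → Subset n → Fin n → Fin n → Fin m → Set (c ⊔ ℓ₂)
  IsBestNeighbor D red z u e =
    NonredNeighbor red z u × IsLightestThrough u z e ×
    (∀ u′ e′ → NonredNeighbor red z u′ → IsLightestThrough u′ z e′ →
       D u +⁺ weight e ≤⁺ D u′ +⁺ weight e′)

  -- The three cases of what initialization of the red vertices does at z.  Only
  -- nonred vertices are consulted and only red ones change, so the order in which
  -- the red vertices are visited is immaterial.
  data InitializedAt (red : Subset n) (σ σ′ : Store G n m) (Q : Subset n) (z : Fin n)
                     : Set (c ⊔ ℓ₂) where
    untouched : z ∉ red →
                Store.D σ′ z ≡ Store.D σ z → Store.P σ′ z ≡ Store.P σ z →
                Store.E σ′ z ≡ Store.E σ z → z ∉ Q → InitializedAt red σ σ′ Q z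
    isolated  : z ∈ red → ¬ ∃ (NonredNeighbor red z) →
                Store.D σ′ z ≡ ⊤⁺ → Store.P σ′ z ≡ nothing →
                Store.E σ′ z ≡ Store.E σ z → z ∉ Q → InitializedAt red σ σ′ Q z
    attached  : ∀ u e → z ∈ red → IsBestNeighbor (Store.D σ) red z u e →
                Store.D σ′ z ≡ Store.D σ u +⁺ weight e → Store.P σ′ z ≡ just u →
                Store.E σ′ z ≡ just e → z ∈ Q → InitializedAt red σ σ′ Q z

  Initialization : Subset n → Store G n m → Store G n m → Subset n → Set (c ⊔ ℓ₂)
  Initialization red σ σ′ Q = ∀ z → InitializedAt red σ σ′ Q z

  relax : Fin n → Store G n m × Subset n → Fin m × Fin n → Store G n m × Subset n
  relax z (store D P E , Q) (e , v) =
    if does ((D z +⁺ weight e) <⁺? D v)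
    then (store (updateAt D v (const (D z +⁺ weight e)))
                (updateAt P v (const (just z)))
                (updateAt E v (const (just e)))
         , Q ∪ ⁅ v ⁆)
    else (store D P E , Q)

  -- ps lists, in any order, the pairs visited by the nested loop over the
  -- hyperedges e containing z and the vertices v of e.
  Visits : Fin n → List (Fin m × Fin n) → Set
  Visits z ps = ∀ e v → ((e , v) List.∈ ps) ⇔ (z ∈ edge e × v ∈ edge e)

  data Propagation : Store G n m × Subset n → Store G n m → Set (c ⊔ ℓ₂) where
    done : ∀ {σ Q} → Empty Q → Propagation (σ , Q) σ
    step : ∀ {σ Q σ′} z ps → IsDequeued (Store.D σ) Q z → Visits z ps →
           Propagation (foldl (relax z) (σ , Q ∖ z) ps) σ′ →
           Propagation (σ , Q) σ′

module _ {G : OrderedAbelianGroup c ℓ₁ ℓ₂} where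
  open OrderedAbelianGroup G

  -- Execution H ě wₙₑᵥ w<wₙₑᵥ σ σ′: some execution of the algorithm, run from
  -- store σ, terminates with store σ′; ties are broken arbitrarily.
  record Execution (H : Hypergraph G n m) (ě : Fin m) (wₙₑᵥ : Carrier)
                   (w<wₙₑᵥ : Hypergraph.weight H ě < wₙₑᵥ)
                   (σ σ′ : Store G n m) : Set (c ⊔ ℓ₁ ⊔ ℓ₂) where
    H′ : Hypergraph G n m
    H′ = increaseWeight H ě wₙₑᵥ w<wₙₑᵥ
    field
      {σ₁ σ₂}        : Store G n m
      {red Q}        : Subset n
      coloring       : Coloring H′ σ (usersOf H′ σ ě) ∅ σ₁ red
      initialization : Initialization H′ red σ₁ σ₂ Q
      propagation    : Propagation H′ (σ₂ , Q) σ′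

{-# OPTIONS --safe #-}

-- Throughout the coloring process every nonred vertex outside M has a nonred
-- parent that explains its distance with the new weights.  Once M is empty,
-- following the parents therefore proves the distances of the nonred vertices
-- correct: since the new weights are positive, distances strictly decrease along
-- parents.  Once the red vertices are initialized, every stored distance is an
-- upper bound on the true one, every finite D v with v ≢ s is at least
-- D (P v) + w (E v), and the hyperedges at the vertices outside Q are relaxed.
-- When Q is empty this forces D = d′, with equality along the parents.  Neither
-- argument depends on the order in which the queues are emptied; the order only
-- matters for termination, where it ensures that no vertex is dequeued twice.
module Submission where

open import Defs
open import Data.Fin.Base using (Fin)
open import Data.Fin.Induction using (spo-wellFounded)
open import Data.Fin.Properties using (any?; all?) renaming (_≟_ to _≟ᶠ_)
open import Data.Fin.Subset
  using (Subset; _∈_; _∉_; _⊂_; Nonempty; _∩_; _∪_; _─_; ⁅_⁆; inside; outside)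
  renaming (⊥ to ∅; ⊤ to full; _-_ to _∖_)
open import Data.Fin.Subset.Induction using (⊂-wellFounded)
open import Data.Fin.Subset.Properties
open import Data.List.Base using (List; []; _∷_; foldl; filter; allFin; cartesianProduct)
import Data.List.Extrema as Extrema
import Data.List.Membership.Propositional as List
open import Data.List.Membership.Propositional.Properties
  using (∈-allFin; ∈-cartesianProduct⁺; ∈-filter⁺; ∈-filter⁻)
open import Data.List.Relation.Unary.All using (lookup)
open import Data.List.Relation.Unary.All.Properties using (all-filter)
open import Data.List.Relation.Unary.Any using (here; there)
open import Data.Maybe.Base using (Maybe; just; nothing)
open import Data.Maybe.Properties using (just-injective; ≡-dec)
open import Data.Nat.Base using (ℕ; suc) renaming (_<_ to _<ᴺ_)
import Data.Nat.Properties as ℕ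
open import Data.Product.Base using (∃; ∃₂; _×_; _,_; proj₁; proj₂; map₂; uncurry)
open import Data.Product.Relation.Binary.Lex.NonStrict using (×-totalOrder)
open import Data.Sum.Base using (_⊎_; inj₁; inj₂; [_,_]′)
open import Data.Vec.Base using (_∷_; there; tabulate)
open import Data.Vec.Functional using (Vector; updateAt)
open import Data.Vec.Functional.Properties using (updateAt-updates; updateAt-minimal)
open import Data.Vec.Properties using (lookup∘tabulate; []=⇒lookup; lookup⇒[]=)
open import Function.Base using (_∘_; _on_; case_of_; const; id)
open import Function.Bundles using (Equivalence; mk⇔)
open import Induction.WellFounded using (Acc; acc; WellFounded)
open import Level using (Level; _⊔_)
open import Relation.Binary.Bundles using (DecTotalOrder; TotalOrder)
open import Relation.Binary.Construct.Closure.ReflexiveTransitive using (Star; ε; _◅_; fold)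
import Relation.Binary.Construct.Add.Supremum.Equality as Add≈
import Relation.Binary.Construct.Add.Supremum.NonStrict as Add≤
import Relation.Binary.Construct.Add.Supremum.Strict as Add<
import Relation.Binary.Construct.NonStrictToStrict as ToStrict
import Relation.Binary.Construct.On as On
open import Relation.Binary.Core using (Rel)
open import Relation.Binary.PropositionalEquality.Core
  using (_≡_; _≢_; refl; sym; trans; cong; subst)
open import Relation.Binary.Structures using (IsDecTotalOrder)
open import Relation.Nullary.Construct.Add.Supremum using (⊤⁺; [_])
open import Relation.Nullary.Decidable.Core
  using (Dec; yes; no; does; ¬?; _×-dec_; _→-dec_)
open import Relation.Nullary.Decidable using (dec-true)
open import Relation.Nullary.Negation.Core using (¬_; contradiction)
open import Relation.Unary using (Pred; Decidable)

-- Finite subsets and minima over finite types.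

just≢nothing : ∀ {a} {A : Set a} {x : A} → just x ≢ nothing
just≢nothing ()

private
  variable
    a c p ℓ₁ ℓ₂ : Level
    A : Set a
    n m : ℕ

x∈p─q⇒x∉q : ∀ {x} (p q : Subset n) → x ∈ p ─ q → x ∉ q
x∈p─q⇒x∉q (_ ∷ p) (outside ∷ q) (there x∈p─q) (there x∈q) = x∈p─q⇒x∉q p q x∈p─q x∈q
x∈p─q⇒x∉q (_ ∷ p) (inside  ∷ q) (there x∈p─q) (there x∈q) = x∈p─q⇒x∉q p q x∈p─q x∈q

x∈p-y⇒x∈p∧x≢y : ∀ {x y} (p : Subset n) → x ∈ p ∖ y → x ∈ p × x ≢ y
x∈p-y⇒x∈p∧x≢y {y = y} p x∈p-y =
  p─q⊆p p ⁅ y ⁆ x∈p-y , x∉⁅y⁆⇒x≢y (x∈p─q⇒x∉q p ⁅ y ⁆ x∈p-y)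

x∉p-y⇒x≡y⊎x∉p : ∀ {x} y {p : Subset n} → x ∉ p ∖ y → x ≡ y ⊎ x ∉ p
x∉p-y⇒x≡y⊎x∉p {x = x} y x∉p-y with x ≟ᶠ y
... | yes x≡y = inj₁ x≡y
... | no  x≢y = inj₂ λ x∈p → x∉p-y (x∈p∧x≢y⇒x∈p-y x∈p x≢y)

module _ {P : Pred (Fin n) p} (P? : Decidable P) where

  ∈-tabulate⁺ : ∀ {x} → P x → x ∈ tabulate (does ∘ P?)
  ∈-tabulate⁺ {x} px =
    lookup⇒[]= x _ (trans (lookup∘tabulate (does ∘ P?) x) (dec-true (P? x) px))

  ∈-tabulate⁻ : ∀ {x} → x ∈ tabulate (does ∘ P?) → P x
  ∈-tabulate⁻ {x} x∈
    with P? x | trans (sym (lookup∘tabulate (does ∘ P?) x)) ([]=⇒lookup x∈)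
  ... | yes px | _ = px

minimum : (O : TotalOrder c ℓ₁ ℓ₂) (let open TotalOrder O) (f : A → Carrier)
          {P : Pred A p} → Decidable P → (xs : List A) → (∀ x → x List.∈ xs) →
          ∃ P → ∃ λ x → P x × (∀ y → P y → f x ≤ f y)
minimum O f P? xs ∈xs (x , px) =
  -- The given witness `x` is the default value of `argmin`, so the minimizer satisfies `P` in every
  -- case.
  argmin f x ys ,
  argmin-all f px (all-filter P? xs) ,
  λ y py → lookup (f[argmin]≤f[xs] x ys) (∈-filter⁺ P? (∈xs y) py)
  where
  open Extrema O
  ys = filter P? xs

∈-pairs : ((i , j) : Fin n × Fin m) → (i , j) List.∈ cartesianProduct (allFin n) (allFin m)
∈-pairs (i , j) = ∈-cartesianProduct⁺ (∈-allFin i) (∈-allFin j)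

-- Order and addition on distances with a top element.

module DistanceProperties (G : OrderedAbelianGroup c ℓ₁ ℓ₂) where
  open OrderedAbelianGroup G
  open IsDecTotalOrder isDecTotalOrder using (isTotalOrder; isPartialOrder) public

  weightOrder : TotalOrder _ _ _
  weightOrder = record { isTotalOrder = isTotalOrder }

  distanceOrder : DecTotalOrder _ _ _
  distanceOrder = record { isDecTotalOrder = Add≤.≤⁺-isDecTotalOrder _≤_ isDecTotalOrder }

  open DecTotalOrder distanceOrder public
    using ()
    renaming ( refl to ≤⁺-refl; trans to ≤⁺-trans; reflexive to ≤⁺-reflexive
             ; antisym to ≤⁺-antisym; _≟_ to _≟⁺_; module Eq to ≈⁺)

  ≡⇒≤⁺ : ∀ {x y} → x ≡ y → x ≤⁺ y
  ≡⇒≤⁺ refl = ≤⁺-refl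

  ⊤⁺? : (x : Distance) → Dec (x ≡ ⊤⁺)
  ⊤⁺? ⊤⁺    = yes refl
  ⊤⁺? [ _ ] = no λ ()

  ≈⁺⊤⁺⇒≡⊤⁺ : ∀ {x y} → x ≈⁺ y → y ≡ ⊤⁺ → x ≡ ⊤⁺
  ≈⁺⊤⁺⇒≡⊤⁺ Add≈.⊤⁺≈⊤⁺ refl = refl

  ≤⁺⇒≢⊤⁺ : ∀ {x y} → x ≤⁺ y → y ≢ ⊤⁺ → x ≢ ⊤⁺
  ≤⁺⇒≢⊤⁺ (_ Add≤.≤⊤⁺) y≢⊤⁺ refl = y≢⊤⁺ refl

  <⁺⇒≱⁺ : ∀ {x y} → x <⁺ y → ¬ (y ≤⁺ x)
  <⁺⇒≱⁺ Add<.[ x<y ] Add≤.[ y≤x ] = ToStrict.<⇒≱ _≈_ _≤_ antisym x<y y≤x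

  ≮⁺⇒≥⁺ : ∀ {x y} → ¬ (x <⁺ y) → y ≤⁺ x
  ≮⁺⇒≥⁺ {⊤⁺}    {y}     x≮y = y Add≤.≤⊤⁺
  ≮⁺⇒≥⁺ {[ x ]} {⊤⁺}    x≮y = contradiction Add<.[ x ]<⊤⁺ x≮y
  ≮⁺⇒≥⁺ {[ x ]} {[ y ]} x≮y =
    Add≤.[ ToStrict.≮⇒≥ _≈_ _≤_ Eq.sym _≟_ ≤-reflexive total (x≮y ∘ Add<.[_]) ]

  <⁺⇒≤⁺ : ∀ {x y} → x <⁺ y → x ≤⁺ y
  <⁺⇒≤⁺ Add<.[ x<y ]  = Add≤.[ <⇒≤ x<y ]
  <⁺⇒≤⁺ Add<.[ x ]<⊤⁺ = _ Add≤.≤⊤⁺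

  -- `<⁺` itself need not be well-founded on distances, but pulled back along `D` it is a strict
  -- partial order on the finite type `Fin n`. This licenses induction on the distance of a vertex.
  <⁺-wellFounded : (D : Vector Distance n) → WellFounded (_<⁺_ on D)
  <⁺-wellFounded D = spo-wellFounded (On.isStrictPartialOrder D
    (Add<.<⁺-isStrictPartialOrder _<_
      (ToStrict.<-isStrictPartialOrder _≈_ _≤_ isPartialOrder)))

  +-mono-≤ : ∀ {x y v w} → x ≤ y → v ≤ w → x + v ≤ y + w
  +-mono-≤ {x} {y} {v} {w} x≤y v≤w = ≤-trans (+-monoʳ-≤ x v≤w)
    (≤-trans (≤-reflexive (comm x w)) (≤-trans (+-monoʳ-≤ w x≤y) (≤-reflexive (comm w y))))

  x≤x+w : ∀ x {w} → 0# ≤ w → x ≤ x + w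
  x≤x+w x 0≤w = ≤-trans (≤-reflexive (Eq.sym (identityʳ x))) (+-monoʳ-≤ x 0≤w)

  x<x+w : ∀ x {w} → 0# < w → x < x + w
  -- Cancelling `x` from `x ≈ x + w` would give `0# ≈ w`.
  x<x+w x {w} (0≤w , 0≉w) = x≤x+w x 0≤w , λ x≈x+w → 0≉w (begin
    0#              ≈⟨ inverseˡ x ⟨
    - x + x         ≈⟨ ∙-cong Eq.refl x≈x+w ⟩
    - x + (x + w)   ≈⟨ assoc (- x) x w ⟨
    (- x + x) + w   ≈⟨ ∙-cong (inverseˡ x) Eq.refl ⟩
    0# + w          ≈⟨ identityˡ w ⟩
    w               ∎)
    where
    open import Relation.Binary.Reasoning.Setoid (TotalOrder.Eq.setoid weightOrder)

  +⁺-mono-≤⁺ : ∀ {x y v w} → x ≤⁺ y → v ≤ w → x +⁺ v ≤⁺ y +⁺ w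
  +⁺-mono-≤⁺ Add≤.[ x≤y ]   v≤w = Add≤.[ +-mono-≤ x≤y v≤w ]
  +⁺-mono-≤⁺ (x Add≤.≤⊤⁺) v≤w = _ Add≤.≤⊤⁺

  x≤⁺x+w : ∀ {x w} → 0# ≤ w → x ≤⁺ x +⁺ w
  x≤⁺x+w {⊤⁺}    0≤w = ≤⁺-refl
  x≤⁺x+w {[ x ]} 0≤w = Add≤.[ x≤x+w x 0≤w ]

  -- Positivity of the weights enters the proof through this lemma: it turns a parent edge into a
  -- strict decrease of distance. Finiteness of `y` rules out `⊤⁺ ≤⁺ ⊤⁺`, where nothing decreases.
  x+w≤⁺y⇒x<⁺y : ∀ {x y w} → 0# < w → y ≢ ⊤⁺ → x +⁺ w ≤⁺ y → x <⁺ y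
  x+w≤⁺y⇒x<⁺y {⊤⁺}            0<w y≢⊤⁺ (_ Add≤.≤⊤⁺) = contradiction refl y≢⊤⁺
  x+w≤⁺y⇒x<⁺y {[ x ]} {⊤⁺}    0<w y≢⊤⁺ x+w≤y        = contradiction refl y≢⊤⁺
  x+w≤⁺y⇒x<⁺y {[ x ]} {[ y ]} 0<w y≢⊤⁺ Add≤.[ x+w≤y ] =
    Add<.[ ToStrict.<-≤-trans _≈_ _≤_ Eq.sym ≤-trans antisym (proj₁ ≤-resp-≈) (x<x+w x 0<w) x+w≤y ]

  +⁺-assoc-≤⁺ : ∀ x {v w} → (x +⁺ v) +⁺ w ≤⁺ x +⁺ (v + w)
  +⁺-assoc-≤⁺ ⊤⁺            = ≤⁺-refl
  +⁺-assoc-≤⁺ [ x ] {v} {w} = Add≤.[ ≤-reflexive (assoc x v w) ]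

-- Shortest distances: triangle inequality and comparison with relaxed values.

module ShortestDistanceProperties
  {G : OrderedAbelianGroup c ℓ₁ ℓ₂} (H : Hypergraph G n m) (s : Fin n) where
  open OrderedAbelianGroup G
  open DistanceProperties G
  open Hypergraph H

  0≤chainWeight : ∀ {e f} (p : Chain H e f) → 0# ≤ chainWeight H p
  0≤chainWeight [ e ]        = 0≤weight e
  0≤chainWeight (e ∷⟨ _ ⟩ p) = ≤-trans (0≤weight e) (x≤x+w (weight e) (0≤chainWeight p))

  snoc : ∀ {e f g} → Chain H e f → Nonempty (edge f ∩ edge g) → Chain H e g
  snoc [ e ]        f∩g = e ∷⟨ f∩g ⟩ [ _ ]
  snoc (e ∷⟨ i ⟩ p) f∩g = e ∷⟨ i ⟩ snoc p f∩g

  chainWeight-snoc : ∀ {e f g} (p : Chain H e f) (i : Nonempty (edge f ∩ edge g)) →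
                     chainWeight H (snoc p i) ≤ chainWeight H p + weight g
  chainWeight-snoc [ e ]                i  = ≤-refl
  chainWeight-snoc {g = g} (e ∷⟨ _ ⟩ p) i =
    ≤-trans (+-monoʳ-≤ (weight e) (chainWeight-snoc p i))
            (≤-reflexive (Eq.sym (assoc (weight e) (chainWeight H p) (weight g))))

  source-≈0 : ∀ {v x} → v ≡ s → IsShortestDistance H s v x → x ≈⁺ [ 0# ]
  source-≈0 v≡s (source x≈0)          = Add≈.[ x≈0 ]
  source-≈0 v≡s (reachable v≢s _ _ _) = contradiction v≡s v≢s
  source-≈0 v≡s (unreachable v≢s _)   = contradiction v≡s v≢s

  0≤distance : ∀ {v x} → IsShortestDistance H s v x → [ 0# ] ≤⁺ x
  0≤distance (source x≈0)            = Add≤.[ ≤-reflexive (Eq.sym x≈0) ]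
  0≤distance (reachable _ p pw≈x _)  =
    Add≤.[ ≤-trans (0≤chainWeight (Hyperpath.chain p)) (≤-reflexive pw≈x) ]
  0≤distance (unreachable _ _)       = _ Add≤.≤⊤⁺

  extend : ∀ {u v} e → u ∈ edge e → v ∈ edge e → Hyperpath H s u → Hyperpath H s v
  extend e u∈e v∈e p = record
    { start = start ; end = v∈e ; chain = snoc chain (_ , x∈p∩q⁺ (end , u∈e)) }
    where open Hyperpath p

  -- A hyperpath to `u` followed by `e` is a hyperpath to `v`; if `u` is the source, `e` alone is
  -- one. If `v` is the source its distance is zero by convention, and nonnegativity of the
  -- right-hand side suffices.
  triangle : ∀ {u v x y} e → u ∈ edge e → v ∈ edge e →
             IsShortestDistance H s u x → IsShortestDistance H s v y →
             y ≤⁺ x +⁺ weight e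
  triangle e u∈e v∈e dᵤ (source y≈0) = ≤⁺-trans Add≤.[ ≤-reflexive y≈0 ]
    (≤⁺-trans (0≤distance dᵤ) (x≤⁺x+w (0≤weight e)))
  triangle e u∈e v∈e (unreachable _ _) _ = _ Add≤.≤⊤⁺
  triangle e u∈e v∈e (source x≈0) (reachable _ _ _ y≤) =
    Add≤.[ ≤-trans (y≤ record { start = u∈e ; end = v∈e ; chain = [ e ] })
             (≤-reflexive (Eq.trans (Eq.sym (identityˡ (weight e)))
                                    (∙-cong (Eq.sym x≈0) Eq.refl))) ]
  triangle e u∈e v∈e (source _) (unreachable _ ¬p) =
    contradiction record { start = u∈e ; end = v∈e ; chain = [ e ] } ¬p
  triangle e u∈e v∈e (reachable _ p pw≈x _) (reachable _ _ _ y≤) =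
    Add≤.[ ≤-trans (y≤ (extend e u∈e v∈e p))
             (≤-trans (chainWeight-snoc (Hyperpath.chain p) _)
                      (≤-reflexive (∙-cong pw≈x Eq.refl))) ]
  triangle e u∈e v∈e (reachable _ p _ _) (unreachable _ ¬p) =
    contradiction (extend e u∈e v∈e p) ¬p

  module _ (D : Vector Distance n)
           (relaxed : ∀ {u v} e → u ∈ edge e → v ∈ edge e → D v ≤⁺ D u +⁺ weight e)
           where

    -- Induction along the chain, passing through a common vertex `t` of each pair of consecutive
    -- hyperedges.
    relaxed⇒≤chainWeight : ∀ {u v e f} (p : Chain H e f) → u ∈ edge e → v ∈ edge f →
                           D v ≤⁺ D u +⁺ chainWeight H p
    relaxed⇒≤chainWeight [ e ] u∈e v∈e = relaxed e u∈e v∈e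
    relaxed⇒≤chainWeight {u} (_∷⟨_⟩_ e {e′} (t , t∈) p) u∈e v∈f
      with x∈p∩q⁻ (edge e) (edge e′) t∈
    ... | t∈e , t∈e′ = ≤⁺-trans (relaxed⇒≤chainWeight p t∈e′ v∈f)
                         (≤⁺-trans (+⁺-mono-≤⁺ (relaxed e u∈e t∈e) ≤-refl) (+⁺-assoc-≤⁺ (D u)))

    -- This supplies one half of `D ≈ d′`: once the queue of the propagation is empty, the stored
    -- distances satisfy `relaxed`.
    relaxed⇒≤distance : D s ≤⁺ [ 0# ] → ∀ {v x} → IsShortestDistance H s v x → D v ≤⁺ x
    relaxed⇒≤distance Ds≤0 (source x≈0) =
      ≤⁺-trans Ds≤0 Add≤.[ ≤-reflexive (Eq.sym x≈0) ]
    relaxed⇒≤distance Ds≤0 (reachable _ p pw≈x _) =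
      ≤⁺-trans (relaxed⇒≤chainWeight chain start end)
        (≤⁺-trans (+⁺-mono-≤⁺ Ds≤0 ≤-refl) Add≤.[ ≤-reflexive (Eq.trans (identityˡ _) pw≈x) ])
      where open Hyperpath p
    relaxed⇒≤distance Ds≤0 (unreachable _ _) = _ Add≤.≤⊤⁺

-- The invariant of the coloring process.

module AlgorithmProperties
  {G : OrderedAbelianGroup c ℓ₁ ℓ₂} (H : Hypergraph G n m)
  (0<weight : PositiveWeights H) (s : Fin n) where
  open OrderedAbelianGroup G
  open DistanceProperties G
  open Hypergraph H
  open ShortestDistanceProperties H s

  -- `D+w≤D` is an inequality because the propagation may lower `D u` after `v` got its pointers.
  -- Equality is recovered at the end from the triangle inequality for `d′`.
  record ParentEdge (σ : Store G n m) (v u : Fin n) (e : Fin m) : Set (c ⊔ ℓ₂) where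
    constructor parentEdge
    open Store σ
    field
      P≡just : P v ≡ just u
      E≡just : E v ≡ just e
      v∈e    : v ∈ edge e
      u∈e    : u ∈ edge e
      D+w≤D  : D u +⁺ weight e ≤⁺ D v

  -- `on-tree` keeps the source and the unreachable vertices out of the queue, so their pointers are
  -- never overwritten. It also provides the finiteness that strict descent requires.
  record ColoringInvariant (σ : Store G n m) (M red : Subset n) : Set (c ⊔ ℓ₁ ⊔ ℓ₂) where
    open Store σ
    field
      D-source  : D s ≈⁺ [ 0# ]
      root      : P s ≡ nothing × E s ≡ nothing
      off-tree  : ∀ v → D v ≡ ⊤⁺ → P v ≡ nothing × E v ≡ nothing
      on-tree   : ∀ v → v ∈ M ⊎ v ∈ red → v ≢ s × D v ≢ ⊤⁺
      supported : ∀ v → v ≢ s → D v ≢ ⊤⁺ → v ∉ M → v ∉ red →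
                  ∃₂ λ u e → u ∉ red × ParentEdge σ v u e

  coloring-preserves-D : ∀ {σ σ′ M red red′} → Coloring H σ M red σ′ red′ →
                         Store.D σ′ ≡ Store.D σ
  coloring-preserves-D (done _)              = refl
  coloring-preserves-D (pinkStep _ _ _ _ _ C) = coloring-preserves-D C
  coloring-preserves-D (redStep _ _ _ C)     = coloring-preserves-D C

  -- The support found for `z` is the parent edge that `supported` demands as soon as `z` has left
  -- `M`; no other vertex changes.
  pinkStep-invariant : ∀ {σ M red z q e} → z ∈ M → Support H σ red z q e →
                       ColoringInvariant σ M red →
                       ColoringInvariant (setParent H σ z q e) (M ∖ z) red
  pinkStep-invariant {σ} {M} {red} {z} {q} {e} z∈M (q∉red , q∈e , z∈e , D+w≈D) I = record
    { D-source  = I.D-source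
    ; root      = unchanged (proj₁ z-on-tree ∘ sym) I.root
    ; off-tree  = λ v Dv≡⊤⁺ →
        unchanged (λ v≡z → proj₂ z-on-tree (trans (cong D (sym v≡z)) Dv≡⊤⁺)) (I.off-tree v Dv≡⊤⁺)
    ; on-tree   = λ { v (inj₁ v∈)    → I.on-tree v (inj₁ (proj₁ (x∈p-y⇒x∈p∧x≢y M v∈)))
                    ; v (inj₂ v∈red) → I.on-tree v (inj₂ v∈red) }
    ; supported = supported
    }
    where
    module I = ColoringInvariant I
    open Store σ
    σ⁺ = setParent H σ z q e
    z-on-tree = I.on-tree z (inj₁ z∈M)

    unchanged : ∀ {v p f} → v ≢ z → P v ≡ p × E v ≡ f →
                Store.P σ⁺ v ≡ p × Store.E σ⁺ v ≡ f
    unchanged {v} v≢z (Pv≡ , Ev≡) =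
      trans (updateAt-minimal v z P v≢z) Pv≡ , trans (updateAt-minimal v z E v≢z) Ev≡

    supported : ∀ v → v ≢ s → D v ≢ ⊤⁺ → v ∉ M ∖ z → v ∉ red →
                ∃₂ λ u f → u ∉ red × ParentEdge σ⁺ v u f
    supported v v≢s Dv≢⊤⁺ v∉ v∉red with v ≟ᶠ z
    ... | yes refl = q , e , q∉red ,
      parentEdge (updateAt-updates z P) (updateAt-updates z E) z∈e q∈e (≤⁺-reflexive D+w≈D)
    ... | no  v≢z with I.supported v v≢s Dv≢⊤⁺ (v∉ ∘ λ v∈M → x∈p∧x≢y⇒x∈p-y v∈M v≢z) v∉red
    ...   | u , f , u∉red , parentEdge Pv≡ Ev≡ v∈f u∈f D+w≤D = u , f , u∉red ,
      parentEdge (proj₁ (unchanged v≢z (Pv≡ , Ev≡))) (proj₂ (unchanged v≢z (Pv≡ , Ev≡)))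
                 v∈f u∈f D+w≤D

  module _ (σ : Store G n m) where
    open Store σ

    v∈childrenOf⁺ : ∀ {z v} → P v ≡ just z → v ∈ childrenOf H σ z
    v∈childrenOf⁺ {z} = ∈-tabulate⁺ λ v → ≡-dec _≟ᶠ_ (P v) (just z)

    v∈childrenOf⁻ : ∀ {z v} → v ∈ childrenOf H σ z → P v ≡ just z
    v∈childrenOf⁻ {z} = ∈-tabulate⁻ λ v → ≡-dec _≟ᶠ_ (P v) (just z)

    users? : ∀ ě → Decidable λ v → v ∈ edge ě × E v ≡ just ě
    users? ě v = v ∈? edge ě ×-dec ≡-dec _≟ᶠ_ (E v) (just ě)

    v∈usersOf⁺ : ∀ {ě v} → v ∈ edge ě → E v ≡ just ě → v ∈ usersOf H σ ě
    v∈usersOf⁺ {ě} v∈ě Ev≡ = ∈-tabulate⁺ (users? ě) (v∈ě , Ev≡)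

    v∈usersOf⁻ : ∀ {ě v} → v ∈ usersOf H σ ě → E v ≡ just ě
    v∈usersOf⁻ {ě} v∈ = proj₂ (∈-tabulate⁻ (users? ě) v∈)

  -- Coloring `z` red invalidates only the parent edges that lead to `z`. Their owners are the
  -- children of `z`, which enter the queue and are thereby exempt from `supported`.
  redStep-invariant : ∀ {σ M red z} → z ∈ M → ColoringInvariant σ M red →
                      ColoringInvariant σ ((M ∖ z) ∪ childrenOf H σ z) (red ∪ ⁅ z ⁆)
  redStep-invariant {σ} {M} {red} {z} z∈M I = record
    { D-source  = I.D-source
    ; root      = I.root
    ; off-tree  = I.off-tree
    ; on-tree   = on-tree
    ; supported = supported
    }
    where
    module I = ColoringInvariant I
    open Store σ

    child-on-tree : ∀ {v} → P v ≡ just z → v ≢ s × D v ≢ ⊤⁺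
    child-on-tree {v} Pv≡ =
      (λ { refl → just≢nothing (trans (sym Pv≡) (proj₁ I.root)) }) ,
      (λ Dv≡⊤⁺ → just≢nothing (trans (sym Pv≡) (proj₁ (I.off-tree v Dv≡⊤⁺))))

    on-tree : ∀ v → v ∈ (M ∖ z) ∪ childrenOf H σ z ⊎ v ∈ red ∪ ⁅ z ⁆ → v ≢ s × D v ≢ ⊤⁺
    on-tree v (inj₁ v∈) with x∈p∪q⁻ (M ∖ z) _ v∈
    ... | inj₁ v∈M = I.on-tree v (inj₁ (proj₁ (x∈p-y⇒x∈p∧x≢y M v∈M)))
    ... | inj₂ v∈c = child-on-tree (v∈childrenOf⁻ σ v∈c)
    on-tree v (inj₂ v∈) with x∈p∪q⁻ red _ v∈
    ... | inj₁ v∈red = I.on-tree v (inj₂ v∈red)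
    ... | inj₂ v∈⁅z⁆ with refl ← x∈⁅y⁆⇒x≡y z v∈⁅z⁆ = I.on-tree z (inj₁ z∈M)

    supported : ∀ v → v ≢ s → D v ≢ ⊤⁺ → v ∉ (M ∖ z) ∪ childrenOf H σ z → v ∉ red ∪ ⁅ z ⁆ →
                ∃₂ λ u e → u ∉ red ∪ ⁅ z ⁆ × ParentEdge σ v u e
    supported v v≢s Dv≢⊤⁺ v∉ v∉red∪z =
      let v∉M = λ v∈M → v∉ (x∈p∪q⁺ (inj₁ (x∈p∧x≢y⇒x∈p-y v∈M
                          λ { refl → v∉red∪z (x∈p∪q⁺ (inj₂ (x∈⁅x⁆ z))) })))
          u , e , u∉red , pe = I.supported v v≢s Dv≢⊤⁺ v∉M (v∉red∪z ∘ x∈p∪q⁺ ∘ inj₁)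
      in u , e ,
         (λ u∈ → [ u∉red
                 , (λ u∈⁅z⁆ → v∉ (x∈p∪q⁺ (inj₂ (v∈childrenOf⁺ σ
                      (trans (ParentEdge.P≡just pe) (cong just (x∈⁅y⁆⇒x≡y z u∈⁅z⁆)))))))
                 ]′ (x∈p∪q⁻ red _ u∈)) ,
         pe

  coloring-invariant : ∀ {σ σ′ M red red′} → Coloring H σ M red σ′ red′ →
                       ColoringInvariant σ M red → ColoringInvariant σ′ ∅ red′
  coloring-invariant (done M-empty) I = record
    { D-source  = I.D-source
    ; root      = I.root
    ; off-tree  = I.off-tree
    ; on-tree   = λ { v (inj₁ v∈∅) → contradiction v∈∅ ∉⊥
                    ; v (inj₂ v∈red) → I.on-tree v (inj₂ v∈red) }
    ; supported = λ v v≢s Dv≢⊤⁺ _ → I.supported v v≢s Dv≢⊤⁺ (λ v∈M → M-empty (v , v∈M))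
    }
    where module I = ColoringInvariant I
  coloring-invariant (pinkStep z q e (z∈M , _) sup C) I =
    coloring-invariant C (pinkStep-invariant z∈M sup I)
  coloring-invariant (redStep z (z∈M , _) _ C) I =
    coloring-invariant C (redStep-invariant z∈M I)

  -- Termination of the coloring process.

  support? : ∀ σ red z → Dec (∃₂ (Support H σ red z))
  support? σ red z = any? λ q → any? λ e →
    ¬? (q ∈? red) ×-dec q ∈? edge e ×-dec z ∈? edge e ×-dec
    (Store.D σ q +⁺ weight e ≟⁺ Store.D σ z)

  -- The vertices are dequeued in the order of their ranks, each at most once; U
  -- is the set of those not dequeued yet.
  module _ (D : Vector Distance n) {b ℓ₃ ℓ₄} (O : TotalOrder b ℓ₃ ℓ₄)
           (rank : Fin n → TotalOrder.Carrier O)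
           (D-mono : ∀ {x y} → TotalOrder._≤_ O (rank x) (rank y) → D x ≤⁺ D y) where
    open TotalOrder O using () renaming (_≤_ to _≼_; trans to ≼-trans; total to ≼-total)

    coloring-terminates : ∀ P E {M red U} → Acc _⊂_ U →
      ColoringInvariant (store D P E) M red →
      (∀ {x} → x ∈ M → x ∈ U) →
      (∀ {x y} → x ∉ U → y ∈ M → rank x ≼ rank y) →
      (∀ {v u} → P v ≡ just u → ¬ (rank v ≼ rank u)) →
      ∃₂ λ σ′ red′ → Coloring H (store D P E) M red σ′ red′
    coloring-terminates P E {M} {red} {U} (acc rs) I M⊆U U≼M P-rank with nonempty? M
    ... | no  M-empty = _ , _ , done M-empty
    ... | yes M-nonempty
      with minimum O rank (_∈? M) (allFin n) ∈-allFin M-nonempty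
    ... | z , z∈M , z-min = colorNext (support? (store D P E) red z)
      where
      -- A vertex of minimal rank also has a minimal key, so breaking ties by rank is a legal way to
      -- dequeue.
      z-dequeued : IsDequeued H D M z
      z-dequeued = z∈M , λ v v∈M → D-mono (z-min v v∈M)

      U∖z⊂U : U ∖ z ⊂ U
      U∖z⊂U = x∈p⇒p-x⊂p (M⊆U z∈M)

      M∖z⊆U∖z : ∀ {x} → x ∈ M ∖ z → x ∈ U ∖ z
      M∖z⊆U∖z x∈ = let x∈M , x≢z = x∈p-y⇒x∈p∧x≢y M x∈ in x∈p∧x≢y⇒x∈p-y (M⊆U x∈M) x≢z

      U∖z≼M∖z : ∀ {x y} → x ∉ U ∖ z → y ∈ M ∖ z → rank x ≼ rank y
      U∖z≼M∖z x∉ y∈ with x∉p-y⇒x≡y⊎x∉p z x∉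
      ... | inj₁ refl = z-min _ (proj₁ (x∈p-y⇒x∈p∧x≢y M y∈))
      ... | inj₂ x∉U  = U≼M x∉U (proj₁ (x∈p-y⇒x∈p∧x≢y M y∈))

      children : Subset n
      children = childrenOf H (store D P E) z

      child-rank : ∀ {v} → v ∈ children → ¬ (rank v ≼ rank z)
      child-rank v∈ = P-rank (v∈childrenOf⁻ (store D P E) v∈)

      -- Vertices dequeued so far, `z` included, have rank at most that of `z`, whereas a child of
      -- `z` does not. So no child has been dequeued before.
      child∈U∖z : ∀ {v} → v ∈ children → v ∈ U ∖ z
      child∈U∖z {v} v∈ with v ∈? U ∖ z
      ... | yes v∈U∖z = v∈U∖z
      ... | no  v∉U∖z with x∉p-y⇒x≡y⊎x∉p z v∉U∖z
      ...   | inj₁ refl = contradiction (z-min z z∈M) (child-rank v∈)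
      ...   | inj₂ v∉U  = contradiction (U≼M v∉U z∈M) (child-rank v∈)

      U∖z≼children : ∀ {x y} → x ∉ U ∖ z → y ∈ children → rank x ≼ rank y
      U∖z≼children {x} {y} x∉ y∈ with ≼-total (rank z) (rank y)
      ... | inj₂ y≼z = contradiction y≼z (child-rank y∈)
      ... | inj₁ z≼y with x∉p-y⇒x≡y⊎x∉p z x∉
      ...   | inj₁ refl = z≼y
      ...   | inj₂ x∉U  = ≼-trans (U≼M x∉U z∈M) z≼y

      colorNext : Dec (∃₂ (Support H (store D P E) red z)) →
                  ∃₂ λ σ′ red′ → Coloring H (store D P E) M red σ′ red′
      colorNext (yes (q , e , sup@(_ , _ , _ , D+w≈D))) =
        map₂ (map₂ (pinkStep z q e z-dequeued sup))
          (coloring-terminates _ _ (rs U∖z⊂U) (pinkStep-invariant z∈M sup I)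
            M∖z⊆U∖z U∖z≼M∖z P⁺-rank)
        where
        Dq<Dz : D q <⁺ D z
        Dq<Dz = x+w≤⁺y⇒x<⁺y (0<weight e)
          (proj₂ (ColoringInvariant.on-tree I z (inj₁ z∈M))) (≤⁺-reflexive D+w≈D)

        -- The new parent `q` has a strictly smaller distance than `z`, so its rank is smaller
        -- whatever the order does among ties.
        P⁺-rank : ∀ {v u} → updateAt P z (const (just q)) v ≡ just u → ¬ (rank v ≼ rank u)
        P⁺-rank {v} P⁺v≡ v≼u with v ≟ᶠ z
        ... | no  v≢z = P-rank (trans (sym (updateAt-minimal v z P v≢z)) P⁺v≡) v≼u
        ... | yes refl with refl ← trans (sym (updateAt-updates z P)) P⁺v≡ =
          <⁺⇒≱⁺ Dq<Dz (D-mono v≼u)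
      colorNext (no ¬sup) =
        map₂ (map₂ (redStep z z-dequeued ¬sup))
          (coloring-terminates P E (rs U∖z⊂U) (redStep-invariant z∈M I)
            (λ x∈ → [ M∖z⊆U∖z , child∈U∖z ]′ (x∈p∪q⁻ (M ∖ z) children x∈))
            (λ x∉ y∈ → [ U∖z≼M∖z x∉ , U∖z≼children x∉ ]′ (x∈p∪q⁻ (M ∖ z) children y∈))
            P-rank)

  -- Existence of the initialization of the red vertices.

  isLightestThrough? : ∀ u z → Decidable (IsLightestThrough H u z)
  isLightestThrough? u z e =
    u ∈? edge e ×-dec z ∈? edge e ×-dec
    all? λ e′ → u ∈? edge e′ →-dec (z ∈? edge e′ →-dec weight e ≤? weight e′)

  -- Best neighbors are compared along lightest hyperedges only; the bound on `weight e′` carries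
  -- the comparison over to an arbitrary hyperedge through `u` and `z`.
  lightestThrough : ∀ {u z} e → u ∈ edge e → z ∈ edge e →
                    ∃ λ e′ → IsLightestThrough H u z e′ × weight e′ ≤ weight e
  lightestThrough {u} {z} e u∈e z∈e
    with minimum weightOrder weight (λ f → u ∈? edge f ×-dec z ∈? edge f)
           (allFin m) ∈-allFin (e , u∈e , z∈e)
  ... | e′ , (u∈e′ , z∈e′) , e′-min =
    e′ , (u∈e′ , z∈e′ , λ f u∈f z∈f → e′-min f (u∈f , z∈f)) , e′-min e (u∈e , z∈e)

  nonredNeighbor? : ∀ red z → Decidable (NonredNeighbor H red z)
  nonredNeighbor? red z u = ¬? (u ∈? red) ×-dec any? λ e → u ∈? edge e ×-dec z ∈? edge e

  bestNeighbor : ∀ D red z → ∃ (NonredNeighbor H red z) → ∃₂ (IsBestNeighbor H D red z)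
  bestNeighbor D red z (u₀ , u₀-nn@(_ , e₀ , u₀∈e₀ , z∈e₀)) =
    let e₁ , e₁-lightest , _ = lightestThrough e₀ u₀∈e₀ z∈e₀
        (u , e) , (u-nn , e-lightest) , ue-min =
          minimum (DecTotalOrder.totalOrder distanceOrder)
            (λ (u , e) → D u +⁺ weight e)
            (λ (u , e) → nonredNeighbor? red z u ×-dec isLightestThrough? u z e)
            (cartesianProduct (allFin n) (allFin m)) ∈-pairs
            ((u₀ , e₁) , u₀-nn , e₁-lightest)
    in u , e , u-nn , e-lightest , λ u′ e′ nn lt → ue-min (u′ , e′) (nn , lt)

  -- The cases of `InitializedAt` without the equations about the new store, so that the new store
  -- can be defined by recursion on them.
  data InitialCase (D : Vector Distance n) (red : Subset n) (z : Fin n) : Set (c ⊔ ℓ₂) where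
    nonred   : z ∉ red → InitialCase D red z
    isolated : z ∈ red → ¬ ∃ (NonredNeighbor H red z) → InitialCase D red z
    attached : ∀ u e → z ∈ red → IsBestNeighbor H D red z u e → InitialCase D red z

  initialCase : ∀ D red z → InitialCase D red z
  initialCase D red z with z ∈? red | any? (nonredNeighbor? red z)
  ... | no  z∉red | _      = nonred z∉red
  ... | yes z∈red | no ¬nn = isolated z∈red ¬nn
  ... | yes z∈red | yes nn with u , e , best ← bestNeighbor D red z nn = attached u e z∈red best

  initialization-exists : ∀ σ red → ∃₂ (Initialization H red σ)
  initialization-exists σ red = σ₂ , Q , initializedAt
    where
    open Store σ

    cases : ∀ z → InitialCase D red z
    cases = initialCase D red

    D₂ : ∀ {z} → InitialCase D red z → Distance
    D₂ {z} (nonred _)         = D z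
    D₂     (isolated _ _)     = ⊤⁺
    D₂     (attached u e _ _) = D u +⁺ weight e

    P₂ : ∀ {z} → InitialCase D red z → Maybe (Fin n)
    P₂ {z} (nonred _)         = P z
    P₂     (isolated _ _)     = nothing
    P₂     (attached u _ _ _) = just u

    E₂ : ∀ {z} → InitialCase D red z → Maybe (Fin m)
    E₂ {z} (nonred _)         = E z
    E₂ {z} (isolated _ _)     = E z
    E₂     (attached _ e _ _) = just e

    attached? : Decidable λ z → z ∈ red × ∃ (NonredNeighbor H red z)
    attached? z = z ∈? red ×-dec any? (nonredNeighbor? red z)

    σ₂ = store (D₂ ∘ cases) (P₂ ∘ cases) (E₂ ∘ cases)
    Q  = tabulate (does ∘ attached?)

    initializedAt : ∀ z → InitializedAt H red σ σ₂ Q z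
    initializedAt z with cases z in eq
    ... | nonred z∉red = untouched z∉red (cong D₂ eq) (cong P₂ eq) (cong E₂ eq)
      (λ z∈Q → z∉red (proj₁ (∈-tabulate⁻ attached? z∈Q)))
    ... | isolated z∈red ¬nn = isolated z∈red ¬nn (cong D₂ eq) (cong P₂ eq) (cong E₂ eq)
      (λ z∈Q → ¬nn (proj₂ (∈-tabulate⁻ attached? z∈Q)))
    ... | attached u e z∈red best = attached u e z∈red best (cong D₂ eq) (cong P₂ eq) (cong E₂ eq)
      (∈-tabulate⁺ attached? (z∈red , u , proj₁ best))

  -- Relaxation steps and termination of the propagation.

  RelaxedOutside : Vector Distance n → Subset n → Set (c ⊔ ℓ₂)
  RelaxedOutside D Q = ∀ {x y} e → x ∉ Q → x ∈ edge e → y ∈ edge e → D y ≤⁺ D x +⁺ weight e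

  assign : Store G n m → Fin n → Fin m → Fin n → Store G n m
  assign (store D P E) z e v =
    store (updateAt D v (const (D z +⁺ weight e)))
          (updateAt P v (const (just z)))
          (updateAt E v (const (just e)))

  -- The equations let a caller abstract the result of `relax` and match on `refl`, obtaining the
  -- taken branch together with the inequality that selected it.
  relax-cases : ∀ z σ Q e v →
    (relax H z (σ , Q) (e , v) ≡ (assign σ z e v , Q ∪ ⁅ v ⁆) ×
     Store.D σ z +⁺ weight e <⁺ Store.D σ v) ⊎
    (relax H z (σ , Q) (e , v) ≡ (σ , Q) ×
     Store.D σ v ≤⁺ Store.D σ z +⁺ weight e)
  relax-cases z σ Q e v with (Store.D σ z +⁺ weight e) <⁺? Store.D σ v
  ... | yes D+w<D = inj₁ (refl , D+w<D)
  ... | no  D+w≮D = inj₂ (refl , ≮⁺⇒≥⁺ D+w≮D)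

  module Assignment (σ : Store G n m) {z e v}
                    (D+w<D : Store.D σ z +⁺ weight e <⁺ Store.D σ v) where
    open Store σ
    open Store (assign σ z e v) using () renaming (D to D⁺)

    D⁺v≡ : D⁺ v ≡ D z +⁺ weight e
    D⁺v≡ = updateAt-updates v D

    D⁺≡D : ∀ {x} → x ≢ v → D⁺ x ≡ D x
    D⁺≡D {x} = updateAt-minimal x v D

    -- With nonnegative weights no vertex improves itself, so the key of `z` stays fixed while its
    -- hyperedges are scanned.
    z≢v : z ≢ v
    z≢v refl = <⁺⇒≱⁺ D+w<D (x≤⁺x+w (0≤weight e))

    D⁺≤D : ∀ x → D⁺ x ≤⁺ D x
    D⁺≤D x with x ≟ᶠ v
    ... | no  x≢v  = ≡⇒≤⁺ (D⁺≡D x≢v)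
    ... | yes refl = ≤⁺-trans (≡⇒≤⁺ D⁺v≡) (<⁺⇒≤⁺ D+w<D)

  -- U is the set of the vertices not dequeued yet, z the last one dequeued.
  record Frontier (U : Subset n) (z : Fin n) (state : Store G n m × Subset n)
                  : Set (c ⊔ ℓ₂) where
    open Store (proj₁ state)
    private Q = proj₂ state
    field
      z∉U : z ∉ U
      Q⊆U : ∀ {x} → x ∈ Q → x ∈ U
      U≤z : ∀ {x} → x ∉ U → D x ≤⁺ D z
      z≤Q : ∀ {x} → x ∈ Q → D z ≤⁺ D x

  -- The argument of Dijkstra: a newly assigned value is at least `D z`, while vertices outside `U`
  -- are already at most `D z`. Hence they are never improved and do not return to the queue.
  relax-frontier : ∀ {U z σ Q} e v → Frontier U z (σ , Q) →
                   Frontier U z (relax H z (σ , Q) (e , v))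
  relax-frontier {U} {z} {σ} {Q} e v F
    with relax H z (σ , Q) (e , v) | relax-cases z σ Q e v
  ... | _ | inj₂ (refl , _)     = F
  ... | _ | inj₁ (refl , D+w<D) = record
    { z∉U = F.z∉U
    ; Q⊆U = λ x∈ → case x∈p∪q⁻ Q ⁅ v ⁆ x∈ of λ
        { (inj₁ x∈Q)   → F.Q⊆U x∈Q
        ; (inj₂ x∈⁅v⁆) → subst (_∈ U) (sym (x∈⁅y⁆⇒x≡y v x∈⁅v⁆)) v∈U
        }
    ; U≤z = λ {x} x∉U → ≤⁺-trans (D⁺≤D x) (≤⁺-trans (F.U≤z x∉U) D≤D⁺z)
    ; z≤Q = λ {x} x∈ → ≤⁺-trans (D⁺≤D z) (case x ≟ᶠ v of λ
        { (yes refl) → ≤⁺-trans (x≤⁺x+w (0≤weight e)) (≡⇒≤⁺ (sym D⁺v≡))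
        ; (no  x≢v)  → ≤⁺-trans
            (F.z≤Q ([ id , (λ x∈⁅v⁆ → contradiction (x∈⁅y⁆⇒x≡y v x∈⁅v⁆) x≢v) ]′
                     (x∈p∪q⁻ Q ⁅ v ⁆ x∈)))
            (≡⇒≤⁺ (sym (D⁺≡D x≢v)))
        })
    }
    where
    module F = Frontier F
    open Assignment σ D+w<D

    D≤D⁺z = ≡⇒≤⁺ (sym (D⁺≡D z≢v))

    v∈U : v ∈ U
    v∈U with v ∈? U
    ... | yes v∈U = v∈U
    ... | no  v∉U =
      contradiction (≤⁺-trans (F.U≤z v∉U) (x≤⁺x+w (0≤weight e))) (<⁺⇒≱⁺ D+w<D)

  relaxAll-frontier : ∀ {U z state} ps → Frontier U z state →
                      Frontier U z (foldl (relax H z) state ps)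
  relaxAll-frontier []             F = F
  relaxAll-frontier ((e , v) ∷ ps) F = relaxAll-frontier ps (relax-frontier e v F)

  incident? : ∀ z → Decidable λ ((e , v) : Fin m × Fin n) → z ∈ edge e × v ∈ edge e
  incident? z (e , v) = z ∈? edge e ×-dec v ∈? edge e

  incidentPairs : Fin n → List (Fin m × Fin n)
  incidentPairs z = filter (incident? z) (cartesianProduct (allFin m) (allFin n))

  incidentPairs-visits : ∀ z → Visits H z (incidentPairs z)
  incidentPairs-visits z e v = mk⇔
    (λ ∈ps → proj₂ (∈-filter⁻ (incident? z) {xs = cartesianProduct (allFin m) (allFin n)} ∈ps))
    (∈-filter⁺ (incident? z) (∈-pairs (e , v)))

  -- Recursion on the set `U` of vertices not yet dequeued, which loses `z` in each round;
  -- `Frontier` restores both premises after the scan of `z`.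
  propagation-terminates : ∀ {U} σ Q → Acc _⊂_ U → (∀ {x} → x ∈ Q → x ∈ U) →
    (∀ {x y} → x ∉ U → y ∈ Q → Store.D σ x ≤⁺ Store.D σ y) →
    ∃ (Propagation H (σ , Q))
  propagation-terminates {U} σ Q (acc rs) Q⊆U U≤Q with nonempty? Q
  ... | no  Q-empty = _ , done Q-empty
  ... | yes Q-nonempty
    with minimum (DecTotalOrder.totalOrder distanceOrder) (Store.D σ) (_∈? Q)
           (allFin n) ∈-allFin Q-nonempty
  ... | z , z∈Q , z-min =
    map₂ (step z (incidentPairs z) (z∈Q , z-min) (incidentPairs-visits z))
      (propagation-terminates _ _ (rs (x∈p⇒p-x⊂p (Q⊆U z∈Q))) F.Q⊆U
        λ x∉ y∈ → ≤⁺-trans (F.U≤z x∉) (F.z≤Q y∈))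
    where
    open Store σ

    U∖z≤z : ∀ {x} → x ∉ U ∖ z → D x ≤⁺ D z
    U∖z≤z x∉ with x∉p-y⇒x≡y⊎x∉p z x∉
    ... | inj₁ refl = ≤⁺-refl
    ... | inj₂ x∉U  = U≤Q x∉U z∈Q

    U∖z-frontier : Frontier (U ∖ z) z (σ , Q ∖ z)
    U∖z-frontier = record
      { z∉U = λ z∈ → proj₂ (x∈p-y⇒x∈p∧x≢y U z∈) refl
      ; Q⊆U = λ x∈ → let x∈Q , x≢z = x∈p-y⇒x∈p∧x≢y Q x∈ in x∈p∧x≢y⇒x∈p-y (Q⊆U x∈Q) x≢z
      ; U≤z = U∖z≤z
      ; z≤Q = λ x∈ → z-min _ (proj₁ (x∈p-y⇒x∈p∧x≢y Q x∈))
      }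

    module F = Frontier (relaxAll-frontier (incidentPairs z) U∖z-frontier)

  -- Soundness of the store during initialization and propagation.

  module _ (d′ : Vector Distance n) (d′-shortest : ShortestDistances H s d′) where

    d′-triangle : ∀ {u v} e → u ∈ edge e → v ∈ edge e → d′ v ≤⁺ d′ u +⁺ weight e
    d′-triangle e u∈e v∈e = triangle e u∈e v∈e (d′-shortest _) (d′-shortest _)

    d′≤D⇒d′≤D+w : ∀ {D : Vector Distance n} {u v} e → u ∈ edge e → v ∈ edge e →
                  d′ u ≤⁺ D u → d′ v ≤⁺ D u +⁺ weight e
    d′≤D⇒d′≤D+w e u∈e v∈e d′u≤Du =
      ≤⁺-trans (d′-triangle e u∈e v∈e) (+⁺-mono-≤⁺ d′u≤Du ≤-refl)

    -- `off-tree` refers to `d′` and not to `D`: an isolated red vertex gets distance `⊤⁺` but keeps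
    -- its old `E` until the propagation reaches it. For `D-source` the converse inequality follows
    -- from `d′≤D`.
    record Sound (σ : Store G n m) : Set (c ⊔ ℓ₂) where
      open Store σ
      field
        d′≤D     : ∀ v → d′ v ≤⁺ D v
        D-source : D s ≤⁺ [ 0# ]
        root     : P s ≡ nothing × E s ≡ nothing
        off-tree : ∀ v → d′ v ≡ ⊤⁺ → P v ≡ nothing × E v ≡ nothing
        parented : ∀ v → v ≢ s → D v ≢ ⊤⁺ → ∃₂ (ParentEdge σ v)

    -- Well-founded induction on `D`: the supporting parent is again nonred and strictly closer, and
    -- the triangle inequality for `d′` transfers its bound to `v`.
    nonred⇒d′≤D : ∀ {σ red} → ColoringInvariant σ ∅ red →
                  ∀ v → v ∉ red → d′ v ≤⁺ Store.D σ v
    nonred⇒d′≤D {σ} {red} I v = go v (<⁺-wellFounded D v)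
      where
      open Store σ
      open ColoringInvariant I

      go : ∀ v → Acc (_<⁺_ on D) v → v ∉ red → d′ v ≤⁺ D v
      go v (acc rs) v∉red with v ≟ᶠ s | ⊤⁺? (D v)
      ... | _        | yes Dv≡⊤⁺ = ≤⁺-trans (_ Add≤.≤⊤⁺) (≡⇒≤⁺ (sym Dv≡⊤⁺))
      ... | yes refl | no  _     =
        ≤⁺-reflexive (≈⁺.trans (source-≈0 refl (d′-shortest s)) (≈⁺.sym D-source))
      ... | no v≢s   | no Dv≢⊤⁺ with supported v v≢s Dv≢⊤⁺ ∉⊥ v∉red
      ...   | u , e , u∉red , parentEdge _ _ v∈e u∈e D+w≤D =
        ≤⁺-trans (d′≤D⇒d′≤D+w {D} e u∈e v∈e (go u (rs (x+w≤⁺y⇒x<⁺y (0<weight e) Dv≢⊤⁺ D+w≤D)) u∉red))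
                 D+w≤D

    -- A hyperedge leaving a nonred vertex is relaxed toward nonred vertices by `D-triangle`, and
    -- toward red ones by the choice of the best neighbor. Red vertices outside `Q` have distance
    -- `⊤⁺`, so nothing is required of them.
    initialization-sound : ∀ {σ σ₂ red Q} → ColoringInvariant σ ∅ red →
      (∀ v → d′ v ≡ ⊤⁺ → Store.D σ v ≡ ⊤⁺) →
      (∀ {u v} e → u ∈ edge e → v ∈ edge e → Store.D σ v ≤⁺ Store.D σ u +⁺ weight e) →
      Initialization H red σ σ₂ Q → Sound σ₂ × RelaxedOutside (Store.D σ₂) Q
    initialization-sound {σ} {σ₂} {red} {Q} I unreached D-triangle init =
      record
        { d′≤D     = d′≤D₂
        ; D-source = ≤⁺-trans (≡⇒≤⁺ (D₂≡D s∉red)) (≤⁺-reflexive I.D-source)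
        ; root     = pointers₂ s∉red I.root
        ; off-tree = λ v d′v≡⊤⁺ → let Dv≡⊤⁺ = unreached v d′v≡⊤⁺ in
            pointers₂ (λ v∈red → proj₂ (I.on-tree v (inj₂ v∈red)) Dv≡⊤⁺) (I.off-tree v Dv≡⊤⁺)
        ; parented = parented₂
        } , relaxed₂
      where
      module I = ColoringInvariant I
      open Store σ
      open Store σ₂ renaming (D to D₂; P to P₂; E to E₂)

      s∉red : s ∉ red
      s∉red s∈red = proj₁ (I.on-tree s (inj₂ s∈red)) refl

      D₂≡D : ∀ {v} → v ∉ red → D₂ v ≡ D v
      D₂≡D {v} v∉red with init v
      ... | untouched _ D₂≡ _ _ _         = D₂≡
      ... | isolated v∈red _ _ _ _ _     = contradiction v∈red v∉red
      ... | attached _ _ v∈red _ _ _ _ _ = contradiction v∈red v∉red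

      pointers₂ : ∀ {v p f} → v ∉ red → P v ≡ p × E v ≡ f → P₂ v ≡ p × E₂ v ≡ f
      pointers₂ {v} v∉red (Pv≡ , Ev≡) with init v
      ... | untouched _ _ P₂≡ E₂≡ _       = trans P₂≡ Pv≡ , trans E₂≡ Ev≡
      ... | isolated v∈red _ _ _ _ _     = contradiction v∈red v∉red
      ... | attached _ _ v∈red _ _ _ _ _ = contradiction v∈red v∉red

      d′≤D₂ : ∀ v → d′ v ≤⁺ D₂ v
      d′≤D₂ v with init v
      ... | untouched v∉red D₂≡ _ _ _ = ≤⁺-trans (nonred⇒d′≤D I v v∉red) (≡⇒≤⁺ (sym D₂≡))
      ... | isolated _ _ D₂≡ _ _ _    = ≤⁺-trans (_ Add≤.≤⊤⁺) (≡⇒≤⁺ (sym D₂≡))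
      ... | attached u e _ ((u∉red , _) , (u∈e , v∈e , _) , _) D₂≡ _ _ _ =
        ≤⁺-trans (d′≤D⇒d′≤D+w {D} e u∈e v∈e (nonred⇒d′≤D I u u∉red)) (≡⇒≤⁺ (sym D₂≡))

      parented₂ : ∀ v → v ≢ s → D₂ v ≢ ⊤⁺ → ∃₂ (ParentEdge σ₂ v)
      parented₂ v v≢s D₂v≢⊤⁺ with init v
      ... | isolated _ _ D₂≡ _ _ _ = contradiction D₂≡ D₂v≢⊤⁺
      ... | attached u e _ ((u∉red , _) , (u∈e , v∈e , _) , _) D₂≡ P₂≡ E₂≡ _ = u , e ,
        parentEdge P₂≡ E₂≡ v∈e u∈e
          (≡⇒≤⁺ (trans (cong (_+⁺ weight e) (D₂≡D u∉red)) (sym D₂≡)))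
      ... | untouched v∉red D₂≡ P₂≡ E₂≡ _
        with u , e , u∉red , parentEdge Pv≡ Ev≡ v∈e u∈e D+w≤D
               ← I.supported v v≢s (D₂v≢⊤⁺ ∘ trans D₂≡) ∉⊥ v∉red = u , e ,
        parentEdge (trans P₂≡ Pv≡) (trans E₂≡ Ev≡) v∈e u∈e
          (≤⁺-trans (≡⇒≤⁺ (cong (_+⁺ weight e) (D₂≡D u∉red)))
                    (≤⁺-trans D+w≤D (≡⇒≤⁺ (sym D₂≡))))

      D₂≤D+w : ∀ {x} y e → x ∉ red → x ∈ edge e → y ∈ edge e → D₂ y ≤⁺ D x +⁺ weight e
      D₂≤D+w {x} y e x∉red x∈e y∈e with init y
      ... | untouched _ D₂≡ _ _ _ = ≤⁺-trans (≡⇒≤⁺ D₂≡) (D-triangle e x∈e y∈e)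
      ... | isolated _ ¬nn _ _ _ _ = contradiction (x , x∉red , e , x∈e , y∈e) ¬nn
      ... | attached u f _ (_ , _ , best) D₂≡ _ _ _
        with e′ , e′-lightest , w′≤w ← lightestThrough e x∈e y∈e =
        ≤⁺-trans (≡⇒≤⁺ D₂≡)
          (≤⁺-trans (best x e′ (x∉red , e , x∈e , y∈e) e′-lightest) (+⁺-mono-≤⁺ (≤⁺-refl {D x}) w′≤w))

      relaxed₂ : RelaxedOutside D₂ Q
      relaxed₂ {x} {y} e x∉Q x∈e y∈e with init x
      ... | attached _ _ _ _ _ _ _ x∈Q = contradiction x∈Q x∉Q
      ... | isolated _ _ D₂≡ _ _ _ =
        ≤⁺-trans (_ Add≤.≤⊤⁺) (≡⇒≤⁺ (cong (_+⁺ weight e) (sym D₂≡)))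
      ... | untouched x∉red D₂≡ _ _ _ =
        ≤⁺-trans (D₂≤D+w y e x∉red x∈e y∈e) (≡⇒≤⁺ (cong (_+⁺ weight e) (sym D₂≡)))

    -- `root` and `off-tree` survive because an improved vertex is neither the source, whose value
    -- is already at most zero, nor a vertex at infinite distance, since a strict improvement is
    -- finite and bounds `d′ v`.
    assign-sound : ∀ {σ z e v} → Store.D σ z +⁺ weight e <⁺ Store.D σ v →
                   z ∈ edge e → v ∈ edge e → Sound σ → Sound (assign σ z e v)
    assign-sound {σ} {z} {e} {v} D+w<D z∈e v∈e S = record
      { d′≤D     = d′≤D⁺
      ; D-source = ≤⁺-trans (D⁺≤D s) S.D-source
      ; root     = pointers⁺ s≢v S.root
      ; off-tree = λ x d′x≡⊤⁺ → pointers⁺ (λ { refl → d′v≢⊤⁺ d′x≡⊤⁺ }) (S.off-tree x d′x≡⊤⁺)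
      ; parented = parented⁺
      }
      where
      module S = Sound S
      open Store σ
      open Store (assign σ z e v) using () renaming (D to D⁺; P to P⁺; E to E⁺)
      open Assignment σ D+w<D

      d′v≤D+w : d′ v ≤⁺ D z +⁺ weight e
      d′v≤D+w = d′≤D⇒d′≤D+w {D} e z∈e v∈e (S.d′≤D z)

      d′v≢⊤⁺ : d′ v ≢ ⊤⁺
      d′v≢⊤⁺ d′v≡⊤⁺ = <⁺⇒≱⁺ D+w<D
        (≤⁺-trans (_ Add≤.≤⊤⁺) (≤⁺-trans (≡⇒≤⁺ (sym d′v≡⊤⁺)) d′v≤D+w))

      s≢v : s ≢ v
      s≢v refl = <⁺⇒≱⁺ D+w<D
        (≤⁺-trans S.D-source (≤⁺-trans (0≤distance (d′-shortest v)) d′v≤D+w))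

      pointers⁺ : ∀ {x p f} → x ≢ v → P x ≡ p × E x ≡ f → P⁺ x ≡ p × E⁺ x ≡ f
      pointers⁺ {x} x≢v (Px≡ , Ex≡) =
        trans (updateAt-minimal x v P x≢v) Px≡ , trans (updateAt-minimal x v E x≢v) Ex≡

      d′≤D⁺ : ∀ x → d′ x ≤⁺ D⁺ x
      d′≤D⁺ x with x ≟ᶠ v
      ... | yes refl = ≤⁺-trans d′v≤D+w (≡⇒≤⁺ (sym D⁺v≡))
      ... | no  x≢v  = ≤⁺-trans (S.d′≤D x) (≡⇒≤⁺ (sym (D⁺≡D x≢v)))

      parented⁺ : ∀ x → x ≢ s → D⁺ x ≢ ⊤⁺ → ∃₂ (ParentEdge (assign σ z e v) x)
      parented⁺ x x≢s D⁺x≢⊤⁺ with x ≟ᶠ v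
      ... | yes refl = z , e ,
        parentEdge (updateAt-updates v P) (updateAt-updates v E) v∈e z∈e
          (≡⇒≤⁺ (trans (cong (_+⁺ weight e) (D⁺≡D z≢v)) (sym D⁺v≡)))
      ... | no  x≢v with S.parented x x≢s (D⁺x≢⊤⁺ ∘ trans (D⁺≡D x≢v))
      ...   | u , f , parentEdge Px≡ Ex≡ x∈f u∈f D+w≤D with pointers⁺ x≢v (Px≡ , Ex≡)
      ...     | P⁺x≡ , E⁺x≡ = u , f ,
        parentEdge P⁺x≡ E⁺x≡ x∈f u∈f
          -- The parent `u` may be the improved vertex `v`; lowering its distance preserves the
          -- inequality but not an equality.
          (≤⁺-trans (+⁺-mono-≤⁺ (D⁺≤D u) ≤-refl)
                    (≤⁺-trans D+w≤D (≡⇒≤⁺ (sym (D⁺≡D x≢v)))))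

    -- While `z` is scanned it has already left the queue, though its hyperedges are not all
    -- relaxed. The pairs still to be visited are the permitted exceptions.
    PendingRelaxed : Vector Distance n → Subset n → Fin n → List (Fin m × Fin n) → Set (c ⊔ ℓ₂)
    PendingRelaxed D Q z ps = ∀ {x y} e → x ∉ Q → x ∈ edge e → y ∈ edge e →
      D y ≤⁺ D x +⁺ weight e ⊎ (x ≡ z × (e , y) List.∈ ps)

    relaxAll-sound : ∀ {z} ps σ Q →
      (∀ {e v} → (e , v) List.∈ ps → z ∈ edge e × v ∈ edge e) →
      Sound σ → PendingRelaxed (Store.D σ) Q z ps →
      let σ′ , Q′ = foldl (relax H z) (σ , Q) ps in Sound σ′ × RelaxedOutside (Store.D σ′) Q′
    relaxAll-sound [] σ Q ∈ps S R =
      S , λ e x∉Q x∈e y∈e → [ id , (λ ()) ]′ (R e x∉Q x∈e y∈e)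
    relaxAll-sound {z} ((e , v) ∷ ps) σ Q ∈ps S R
      with relax H z (σ , Q) (e , v) | relax-cases z σ Q e v
    ... | _ | inj₂ (refl , D≤D+w) = relaxAll-sound ps σ Q (∈ps ∘ there) S λ f x∉Q x∈f y∈f →
      case R f x∉Q x∈f y∈f of λ
        { (inj₁ Dy≤)                  → inj₁ Dy≤
        ; (inj₂ (refl , here refl))   → inj₁ D≤D+w
        ; (inj₂ (x≡z  , there fy∈ps)) → inj₂ (x≡z , fy∈ps)
        }
    ... | _ | inj₁ (refl , D+w<D) =
      relaxAll-sound ps (assign σ z e v) (Q ∪ ⁅ v ⁆) (∈ps ∘ there)
        (uncurry (assign-sound D+w<D) (∈ps (here refl)) S) λ {x} {y} f x∉ x∈f y∈f →
      -- The improved `v` is now in the queue, so no inequality starting from `v` is owed; in those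
      -- ending at `v`, the smaller value only helps.
      let x≢v : x ≢ v
          x≢v = λ { refl → x∉ (x∈p∪q⁺ (inj₂ (x∈⁅x⁆ v))) }
      in case R f (x∉ ∘ x∈p∪q⁺ ∘ inj₁) x∈f y∈f of λ
        { (inj₁ Dy≤) → inj₁ (≤⁺-trans (D⁺≤D y) (≤⁺-trans Dy≤
                         (≡⇒≤⁺ (cong (_+⁺ weight f) (sym (D⁺≡D x≢v))))))
        ; (inj₂ (refl , here refl))   →
            inj₁ (≡⇒≤⁺ (trans D⁺v≡ (cong (_+⁺ weight f) (sym (D⁺≡D x≢v)))))
        ; (inj₂ (x≡z  , there fy∈ps)) → inj₂ (x≡z , fy∈ps)
        }
      where open Assignment σ D+w<D

    propagation-sound : ∀ {state σ′} → Propagation H state σ′ →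
      let σ , Q = state in Sound σ → RelaxedOutside (Store.D σ) Q →
      Sound σ′ × RelaxedOutside (Store.D σ′) ∅
    propagation-sound (done Q-empty) S R =
      S , λ e _ x∈e y∈e → R e (λ x∈Q → Q-empty (_ , x∈Q)) x∈e y∈e
    propagation-sound {σ , Q} (step z ps z-dequeued visits π) S R =
      uncurry (propagation-sound π) (relaxAll-sound ps σ (Q ∖ z) (Equivalence.to (visits _ _)) S
        λ e x∉ x∈e y∈e → case x∉p-y⇒x≡y⊎x∉p z x∉ of λ
          { (inj₁ refl) → inj₂ (refl , Equivalence.from (visits _ _) (x∈e , y∈e))
          ; (inj₂ x∉Q)  → inj₁ (R e x∉Q x∈e y∈e)
          })

    -- Correctness of a sound store once the queue is empty.

    module _ {σ : Store G n m} (S : Sound σ) (R : RelaxedOutside (Store.D σ) ∅) where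
      open Store σ
      open Sound S

      sound⇒D≤d′ : ∀ v → D v ≤⁺ d′ v
      sound⇒D≤d′ v = relaxed⇒≤distance D (λ e → R e ∉⊥) D-source (d′-shortest v)

      sound⇒D≈d′ : ∀ v → D v ≈⁺ d′ v
      sound⇒D≈d′ v = ≤⁺-antisym (sound⇒D≤d′ v) (d′≤D v)

      sound⇒correctPointers : CorrectPointers H s d′ σ
      sound⇒correctPointers = record
        { root     = root
        ; off-tree = off-tree
        ; parent   = parent
        ; tree     = λ v d′v≢⊤⁺ → tree v (<⁺-wellFounded D v) (≤⁺⇒≢⊤⁺ (sound⇒D≤d′ v) d′v≢⊤⁺)
        }
        where
        parent : ∀ v → v ≢ s → d′ v ≢ ⊤⁺ →
                 ∃₂ λ u e → P v ≡ just u × E v ≡ just e × v ∈ edge e × u ∈ edge e ×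
                            d′ v ≈⁺ d′ u +⁺ weight e
        parent v v≢s d′v≢⊤⁺ with parented v v≢s (≤⁺⇒≢⊤⁺ (sound⇒D≤d′ v) d′v≢⊤⁺)
        ... | u , e , parentEdge Pv≡ Ev≡ v∈e u∈e D+w≤D = u , e , Pv≡ , Ev≡ , v∈e , u∈e ,
          -- The converse runs through the store: `d′ u` plus the weight is at most `D u` plus the
          -- weight, hence at most `D v`, which is at most `d′ v`.
          ≤⁺-antisym (d′-triangle e u∈e v∈e)
            (≤⁺-trans (+⁺-mono-≤⁺ (d′≤D u) ≤-refl) (≤⁺-trans D+w≤D (sound⇒D≤d′ v)))

        tree : ∀ v → Acc (_<⁺_ on D) v → D v ≢ ⊤⁺ → Star (λ x y → P x ≡ just y) v s
        tree v (acc rs) Dv≢⊤⁺ with v ≟ᶠ s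
        ... | yes refl = ε
        ... | no  v≢s with parented v v≢s Dv≢⊤⁺
        ...   | u , e , parentEdge Pv≡ _ _ _ D+w≤D =
          Pv≡ ◅ tree u (rs (x+w≤⁺y⇒x<⁺y (0<weight e) Dv≢⊤⁺ D+w≤D))
                       (≤⁺⇒≢⊤⁺ (≤⁺-trans (x≤⁺x+w (0≤weight e)) D+w≤D) Dv≢⊤⁺)

-- Depth and rank in the initial relationship tree.

module InitialStoreProperties
  {G : OrderedAbelianGroup c ℓ₁ ℓ₂} {H : Hypergraph G n m} {s : Fin n}
  {d : Vector (OrderedAbelianGroup.Distance G) n} {σ : Store G n m}
  (correct : CorrectPointers H s d σ) where
  open OrderedAbelianGroup G
  open DistanceProperties G
  open Hypergraph H
  open Store σ
  open CorrectPointers correct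

  private
    _⟶_ : Rel (Fin n) _
    x ⟶ y = P x ≡ just y

    length : ∀ {v} → Star _⟶_ v s → ℕ
    length = fold (λ _ _ → ℕ) (λ _ → suc) 0

  -- The root and the vertices off the tree have no pointer, so every pointer is one described by
  -- `parent`.
  parentOf : ∀ {v u} → P v ≡ just u →
             v ≢ s × d v ≢ ⊤⁺ ×
             ∃ λ e → v ∈ edge e × u ∈ edge e × d v ≈⁺ d u +⁺ weight e
  parentOf {v} Pv≡
    with v≢s ← (λ { refl → just≢nothing (trans (sym Pv≡) (proj₁ root)) })
       | dv≢⊤⁺ ← (λ dv≡⊤⁺ → just≢nothing (trans (sym Pv≡) (proj₁ (off-tree v dv≡⊤⁺))))
    with u′ , e , Pv≡′ , _ , v∈e , u′∈e , dv≈ ← parent v v≢s dv≢⊤⁺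
    with refl ← just-injective (trans (sym Pv≡) Pv≡′) =
    v≢s , dv≢⊤⁺ , e , v∈e , u′∈e , dv≈

  -- Pointers are functional and the root has none, so the path to `s` is determined by its start.
  -- This makes `depth` independent of the path chosen by `tree`.
  length-unique : ∀ {v} (p q : Star _⟶_ v s) → length p ≡ length q
  length-unique ε           ε             = refl
  length-unique ε           (Ps≡ ◅ _)     = contradiction refl (proj₁ (parentOf Ps≡))
  length-unique (Ps≡ ◅ _)   ε             = contradiction refl (proj₁ (parentOf Ps≡))
  length-unique (Pv≡u ◅ p)  (Pv≡u′ ◅ q)
    with refl ← just-injective (trans (sym Pv≡u) Pv≡u′) = cong suc (length-unique p q)

  depth : Fin n → ℕ
  depth v with ⊤⁺? (d v)
  -- The default 0 is also the length of the empty path, which settles `depth≡length` at the root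
  -- without knowing that `d s` is finite.
  ... | yes _     = 0
  ... | no dv≢⊤⁺ = length (tree v dv≢⊤⁺)

  depth≡length : ∀ {v} (p : Star _⟶_ v s) → depth v ≡ length p
  depth≡length {v} p with ⊤⁺? (d v)
  depth≡length {v} p         | no dv≢⊤⁺  = length-unique (tree v dv≢⊤⁺) p
  depth≡length {v} ε         | yes dv≡⊤⁺ = refl
  depth≡length {v} (Pv≡ ◅ p) | yes dv≡⊤⁺ = contradiction dv≡⊤⁺ (proj₁ (proj₂ (parentOf Pv≡)))

  d-parent≤d : ∀ {v u} → P v ≡ just u → d u ≤⁺ d v
  d-parent≤d Pv≡ with _ , _ , e , _ , _ , dv≈ ← parentOf Pv≡ =
    ≤⁺-trans (x≤⁺x+w (0≤weight e)) (≤⁺-reflexive (≈⁺.sym dv≈))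

  depth-parent<depth : ∀ {v u} → P v ≡ just u → depth u <ᴺ depth v
  depth-parent<depth {v} {u} Pv≡ =
    ℕ.≤-reflexive (trans (cong suc (depth≡length path)) (sym (depth≡length (Pv≡ ◅ path))))
    where
    path = tree u (≤⁺⇒≢⊤⁺ (d-parent≤d Pv≡) (proj₁ (proj₂ (parentOf Pv≡))))

  -- The depth breaks ties: H may have a hyperedge of weight zero, so that a
  -- child can be at the same distance as its parent.
  rankOrder : TotalOrder _ _ _
  rankOrder = ×-totalOrder distanceOrder ℕ.≤-totalOrder

  open TotalOrder rankOrder using () renaming (_≤_ to _≼_)

  rank : Fin n → Distance × ℕ
  rank v = D v , depth v

  rank-mono : ∀ {x y} → rank x ≼ rank y → D x ≤⁺ D y
  rank-mono (inj₁ (Dx≤Dy , _)) = Dx≤Dy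
  rank-mono (inj₂ (Dx≈Dy , _)) = ≤⁺-reflexive Dx≈Dy

  rank-parent : (∀ v → D v ≈⁺ d v) → ∀ {v u} → P v ≡ just u → ¬ (rank v ≼ rank u)
  rank-parent D≈d {v} {u} Pv≡ (inj₁ (Dv≤Du , Dv≉Du)) =
    Dv≉Du (≤⁺-antisym Dv≤Du (≤⁺-trans (≤⁺-reflexive (D≈d u))
      (≤⁺-trans (d-parent≤d Pv≡) (≤⁺-reflexive (≈⁺.sym (D≈d v))))))
  rank-parent D≈d Pv≡ (inj₂ (_ , depth≤)) = ℕ.<⇒≱ (depth-parent<depth Pv≡) depth≤

-- The weight increase: from the initial store to the final one.

module WeightIncrease
  {G : OrderedAbelianGroup c ℓ₁ ℓ₂} (H : Hypergraph G n m) (s : Fin n) (ě : Fin m)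
  {wₙₑᵥ : OrderedAbelianGroup.Carrier G}
  (w<wₙₑᵥ : OrderedAbelianGroup._<_ G (Hypergraph.weight H ě) wₙₑᵥ)
  (0<weight′ : PositiveWeights (increaseWeight H ě wₙₑᵥ w<wₙₑᵥ))
  {d d′ : Vector (OrderedAbelianGroup.Distance G) n}
  (d-shortest : ShortestDistances H s d)
  (d′-shortest : ShortestDistances (increaseWeight H ě wₙₑᵥ w<wₙₑᵥ) s d′)
  (σ : Store G n m)
  (D≈d : ∀ v → OrderedAbelianGroup._≈⁺_ G (Store.D σ v) (d v))
  (correct : CorrectPointers H s d σ) where

  H′ : Hypergraph G n m
  H′ = increaseWeight H ě wₙₑᵥ w<wₙₑᵥ

  open OrderedAbelianGroup G
  open Store σ
  open DistanceProperties G
  open Hypergraph H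
  open Hypergraph H′ using () renaming (weight to weight′)
  open CorrectPointers correct
  open InitialStoreProperties correct
  open AlgorithmProperties H′ 0<weight′ s

  weight′≡weight : ∀ e → e ≢ ě → weight′ e ≡ weight e
  weight′≡weight e e≢ě = updateAt-minimal e ě weight e≢ě

  weight≤weight′ : ∀ e → weight e ≤ weight′ e
  weight≤weight′ e with e ≟ᶠ ě
  ... | yes refl = ≤-trans (<⇒≤ w<wₙₑᵥ) (≤-reflexive (Eq.reflexive (sym (updateAt-updates ě weight))))
  ... | no  e≢ě  = ≤-reflexive (Eq.reflexive (sym (weight′≡weight e e≢ě)))

  D-triangle : ∀ {u v} e → u ∈ edge e → v ∈ edge e → D v ≤⁺ D u +⁺ weight′ e
  D-triangle {u} {v} e u∈e v∈e = ≤⁺-trans (≤⁺-reflexive (D≈d v))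
    (≤⁺-trans (ShortestDistanceProperties.triangle H s e u∈e v∈e (d-shortest u) (d-shortest v))
              (+⁺-mono-≤⁺ (≤⁺-reflexive (≈⁺.sym (D≈d u))) (weight≤weight′ e)))

  dv≡⊤⁺ : ∀ {v} → D v ≡ ⊤⁺ → d v ≡ ⊤⁺
  dv≡⊤⁺ {v} = ≈⁺⊤⁺⇒≡⊤⁺ (≈⁺.sym (D≈d v))

  -- Reachability does not depend on the weights. Walking the old tree path from `v` to `s` with the
  -- new triangle inequality shows that `d′ v` is finite whenever `d v` is.
  unreached : ∀ v → d′ v ≡ ⊤⁺ → D v ≡ ⊤⁺
  unreached v d′v≡⊤⁺ with ⊤⁺? (d v)
  ... | yes dv≡⊤⁺ = ≈⁺⊤⁺⇒≡⊤⁺ (D≈d v) dv≡⊤⁺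
  ... | no  dv≢⊤⁺ = contradiction d′v≡⊤⁺ (d′-finite (tree v dv≢⊤⁺))
    where
    d′-finite : ∀ {v} → Star (λ x y → P x ≡ just y) v s → d′ v ≢ ⊤⁺
    d′-finite ε         = ≤⁺⇒≢⊤⁺ (≤⁺-reflexive
      (ShortestDistanceProperties.source-≈0 H′ s refl (d′-shortest s))) λ ()
    d′-finite (_◅_ {j = u} Pv≡ p) with parentOf Pv≡ | d′ u in d′u≡
    ... | _                         | ⊤⁺    = contradiction d′u≡ (d′-finite p)
    ... | _ , _ , e , v∈e , u∈e , _ | [ x ] = ≤⁺⇒≢⊤⁺
      (≤⁺-trans (d′-triangle d′ d′-shortest e u∈e v∈e) (≡⇒≤⁺ (cong (_+⁺ weight′ e) d′u≡))) λ ()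

  -- A parent edge through a hyperedge other than `ě` keeps its weight and hence its validity; the
  -- vertices using `ě` are exactly those put into the initial queue.
  coloringInvariant : ColoringInvariant σ (usersOf H′ σ ě) ∅
  coloringInvariant = record
    { D-source  = ≈⁺.trans (D≈d s)
                    (ShortestDistanceProperties.source-≈0 H s refl (d-shortest s))
    ; root      = root
    ; off-tree  = λ v → off-tree v ∘ dv≡⊤⁺
    ; on-tree   = λ { v (inj₁ v∈) → user-on-tree (v∈usersOf⁻ σ {ě} v∈)
                    ; v (inj₂ v∈∅) → contradiction v∈∅ ∉⊥ }
    ; supported = supported
    }
    where
    user-on-tree : ∀ {v} → E v ≡ just ě → v ≢ s × D v ≢ ⊤⁺
    user-on-tree {v} Ev≡ =
      (λ { refl → just≢nothing (trans (sym Ev≡) (proj₂ root)) }) ,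
      (λ Dv≡⊤⁺ → just≢nothing (trans (sym Ev≡) (proj₂ (off-tree v (dv≡⊤⁺ Dv≡⊤⁺)))))

    supported : ∀ v → v ≢ s → D v ≢ ⊤⁺ → v ∉ usersOf H′ σ ě → v ∉ ∅ →
                ∃₂ λ u e → u ∉ ∅ × ParentEdge σ v u e
    supported v v≢s Dv≢⊤⁺ v∉users _
      with u , e , Pv≡ , Ev≡ , v∈e , u∈e , dv≈ ← parent v v≢s (Dv≢⊤⁺ ∘ ≈⁺⊤⁺⇒≡⊤⁺ (D≈d v)) =
      u , e , ∉⊥ , parentEdge Pv≡ Ev≡ v∈e u∈e
        (≤⁺-trans (+⁺-mono-≤⁺ (≤⁺-reflexive (D≈d u)) w′≤w)
          (≤⁺-reflexive (≈⁺.trans (≈⁺.sym dv≈) (≈⁺.sym (D≈d v)))))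
      where
      e≢ě : e ≢ ě
      e≢ě refl = v∉users (v∈usersOf⁺ σ v∈e Ev≡)

      w′≤w : weight′ e ≤ weight e
      w′≤w = ≤-reflexive (Eq.reflexive (weight′≡weight e e≢ě))

  execution-exists : ∃ (Execution H ě wₙₑᵥ w<wₙₑᵥ σ)
  execution-exists =
    -- At the start of either loop nothing has been dequeued, so `U` is `full` and the premise about
    -- vertices outside `U` is vacuous.
    let _  , red , C = coloring-terminates D rankOrder rank rank-mono P E {U = full}
                         (⊂-wellFounded full) coloringInvariant
                         (λ _ → ∈⊤) (λ x∉ _ → contradiction ∈⊤ x∉) (rank-parent D≈d)
        σ₂ , Q , I   = initialization-exists _ red
        σ′ , π       = propagation-terminates {U = full} σ₂ Q (⊂-wellFounded full)
                         (λ _ → ∈⊤) (λ x∉ _ → contradiction ∈⊤ x∉)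
    in σ′ , record { coloring = C ; initialization = I ; propagation = π }

  execution-correct : ∀ {σ′} → Execution H ě wₙₑᵥ w<wₙₑᵥ σ σ′ →
                      (∀ v → Store.D σ′ v ≈⁺ d′ v) × CorrectPointers H′ s d′ σ′
  execution-correct {σ′} X = sound⇒D≈d′ _ d′-shortest S R , sound⇒correctPointers _ d′-shortest S R
    where
    open Execution X using (σ₁; σ₂; red; Q; coloring; initialization; propagation)

    D₁≡D : Store.D σ₁ ≡ D
    D₁≡D = coloring-preserves-D coloring

    S₂R₂ : Sound d′ d′-shortest σ₂ × RelaxedOutside (Store.D σ₂) Q
    S₂R₂ = initialization-sound d′ d′-shortest (coloring-invariant coloring coloringInvariant)
      (λ v → subst (λ D → D v ≡ ⊤⁺) (sym D₁≡D) ∘ unreached v)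
      (λ {u} {v} e u∈e v∈e →
         subst (λ D → D v ≤⁺ D u +⁺ weight′ e) (sym D₁≡D) (D-triangle e u∈e v∈e))
      initialization

    SR : Sound d′ d′-shortest σ′ × RelaxedOutside (Store.D σ′) ∅
    SR = uncurry (propagation-sound d′ d′-shortest propagation) S₂R₂

    S = proj₁ SR
    R = proj₂ SR

theorem2 : ∀ {c ℓ₁ ℓ₂} (G : OrderedAbelianGroup c ℓ₁ ℓ₂) (let open OrderedAbelianGroup G) →
    ∀ (n m : ℕ) (H : Hypergraph G n m) (s : Fin n) (ě : Fin m) (wₙₑᵥ : Carrier) →
    (w<wₙₑᵥ : Hypergraph.weight H ě < wₙₑᵥ) →
    (let H′ = increaseWeight H ě wₙₑᵥ w<wₙₑᵥ) →
    PositiveWeights H′ →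
    ∀ (d d′ : Vector Distance n) →
    ShortestDistances H s d → ShortestDistances H′ s d′ →
    ∀ (σ : Store G n m) →
    (∀ v → Store.D σ v ≈⁺ d v) → CorrectPointers H s d σ →
    ∃ (Execution H ě wₙₑᵥ w<wₙₑᵥ σ) ×
    (∀ σ′ → Execution H ě wₙₑᵥ w<wₙₑᵥ σ σ′ →
    (∀ v → Store.D σ′ v ≈⁺ d′ v) × CorrectPointers H′ s d′ σ′)
theorem2 G n m H s ě wₙₑᵥ w<wₙₑᵥ 0<weight′ d d′ d-shortest d′-shortest σ D≈d correct =
  execution-exists , λ σ′ → execution-correct
  where open WeightIncrease H s ě w<wₙₑᵥ 0<weight′ d-shortest d′-shortest σ D≈d correct
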